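{- For every prime power $q$ and every $0<\varepsilon<1/2$ there exists a constant $c=c(q,\varepsilon)$ such that for every composite integer $n>c$, $$C_q(n)\le \frac{q^n}{n^{1/2-\varepsilon}}.$$
   Context: $\mathbb{F}_q$ is the finite field with $q$ elements. A finite ring $S$ is a Carmichael ring if $S$ is not a field and $a^{|S|}=a$ for every $a\in S$. A polynomial $f\in\mathbb{F}_q[t]$ is a Carmichael polynomial if $\mathbb{F}_q[t]/(f)$ is a Carmichael ring. $C_q(n)$ denotes the number of monic Carmichael polynomials in $\mathbb{F}_q[t]$ of degree $n$. -}

module Defs where

open import Level using (Level; _⊔_) renaming (suc to lsuc)
open import Algebra.Bundles using (Ring; CommutativeRing)
open import Data.Nat.Base using (ℕ; zero; suc; _+_; _*_; _^_; _≤_; _<_; _≥_; _>_; z≤n; s≤s)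
import Data.Nat.Properties as ℕₚ
open import Data.Nat.Primality using (Prime)
open import Data.Integer.Base using (+_; -[1+_])
open import Data.Rational.Base using (ℚ; 0ℚ; ↥_; ↧ₙ_)
  renaming (_<_ to _<ʳ_; _+_ to _+ʳ_; _-_ to _-ʳ_; -_ to -ʳ_)
import Data.Rational.Properties as ℚₚ
open import Data.Fin.Base using (Fin; zero; suc; toℕ; fromℕ<; combine; finToFun; funToFin)
import Data.Fin.Properties as Finₚ
import Data.Fin.Permutation as Perm
open import Data.List.Base using (List; []; _∷_; map; tabulate)
open import Data.Product.Base using (Σ; ∃; ∃₂; ∃-syntax; _×_; _,_; proj₁; proj₂)
open import Data.Sum.Base using (_⊎_; inj₁; inj₂; swap)
open import Function.Base using (_∘_)
open import Function.Bundles using (Inverse; Equivalence; _⇔_; mk⇔)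
import Function.Construct.Composition as Compose
import Function.Construct.Symmetry as Symmetry
open import Relation.Nullary using (¬_; Dec; yes; no; contradiction)
open import Relation.Nullary.Decidable using (map′; _×-dec_; _→-dec_; ¬?)
open import Relation.Unary using (Pred)
open import Relation.Binary.Bundles using (Setoid)
open import Relation.Binary.Definitions using (_Respects_)
import Relation.Binary.Definitions as B
import Relation.Binary.Construct.On as On
open import Relation.Binary.PropositionalEquality.Core as ≡ using (_≡_)
import Relation.Binary.PropositionalEquality.Properties as ≡
import Relation.Binary.Reasoning.Setoid as SetoidReasoning
import Algebra.Properties.Ring as RingProperties
import Algebra.Properties.Semiring.Exp as Exp
import Algebra.Properties.Semiring.Divisibility as Divisibility

private
  variable
    a ℓ p : Level

HasCardinality : ℕ → Setoid a ℓ → Set (a ⊔ ℓ)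
HasCardinality n S = Inverse (≡.setoid (Fin n)) S

-- Elements are compared by their first component only, so distinct proofs of
-- P x do not inflate the cardinality.

Subsetoid : (S : Setoid a ℓ) → Pred (Setoid.Carrier S) p → Setoid (a ⊔ p) ℓ
Subsetoid S P = On.setoid {B = Σ (Setoid.Carrier S) P} S proj₁

cardinality-unique : ∀ {m n} {S : Setoid a ℓ} →
                     HasCardinality m S → HasCardinality n S → m ≡ n
cardinality-unique {S = S} e f = Perm.↔⇒≡ (Compose.inverse e (Symmetry.inverse f))

private

  subFin : ∀ n {P : Pred (Fin n) p} → (∀ i → Dec (P i)) →
           ∃[ k ] HasCardinality k (Subsetoid (≡.setoid (Fin n)) P)
  subFin zero P? = 0 , record
    { to = λ () ; from = λ () ; to-cong = λ { {()} } ; from-cong = λ { {() , _} }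
    ; inverse = (λ { {() , _} }) , (λ { {()} }) }
  subFin (suc n) {P} P? with subFin n (P? ∘ suc) | P? zero
  ... | k , e | no ¬p = k , record
    { to = λ i → suc (proj₁ (E.to i)) , proj₂ (E.to i)
    ; from = from
    ; to-cong = λ eq → ≡.cong suc (E.to-cong eq)
    ; from-cong = λ {x} {y} → from-cong {x} {y}
    ; inverse = (λ {x} {y} → invˡ {x} {y}) , λ {x} {y} → invʳ {x} {y}
    }
    where
    module E = Inverse e
    from : Σ (Fin (suc n)) P → Fin k
    from (zero , p) = contradiction p ¬p
    from (suc i , p) = E.from (i , p)
    from-cong : ∀ {x y} → proj₁ x ≡ proj₁ y → from x ≡ from y
    from-cong {zero , p} {zero , q} eq = contradiction p ¬p
    from-cong {suc i , p} {suc .i , q} ≡.refl = E.from-cong {i , p} {i , q} ≡.refl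
    invˡ : ∀ {x} {y} → y ≡ from x → suc (proj₁ (E.to y)) ≡ proj₁ x
    invˡ {zero , p} eq = contradiction p ¬p
    invˡ {suc i , p} eq = ≡.cong suc (E.inverseˡ {i , p} eq)
    invʳ : ∀ {x} {y} → proj₁ y ≡ suc (proj₁ (E.to x)) → from y ≡ x
    invʳ {x} {suc j , q} eq = E.inverseʳ {x} {j , q} (Finₚ.suc-injective eq)
  ... | k , e | yes p₀ = suc k , record
    { to = to
    ; from = from
    ; to-cong = λ { ≡.refl → ≡.refl }
    ; from-cong = λ {x} {y} → from-cong {x} {y}
    ; inverse = (λ {x} {y} → invˡ {x} {y}) , λ {x} {y} → invʳ {x} {y}
    }
    where
    module E = Inverse e
    to : Fin (suc k) → Σ (Fin (suc n)) P
    to zero = zero , p₀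
    to (suc i) = suc (proj₁ (E.to i)) , proj₂ (E.to i)
    from : Σ (Fin (suc n)) P → Fin (suc k)
    from (zero , p) = zero
    from (suc i , p) = suc (E.from (i , p))
    from-cong : ∀ {x y} → proj₁ x ≡ proj₁ y → from x ≡ from y
    from-cong {zero , p} {zero , q} eq = ≡.refl
    from-cong {suc i , p} {suc .i , q} ≡.refl = ≡.cong suc (E.from-cong {i , p} {i , q} ≡.refl)
    invˡ : ∀ {x} {y} → y ≡ from x → proj₁ (to y) ≡ proj₁ x
    invˡ {zero , p} ≡.refl = ≡.refl
    invˡ {suc i , p} ≡.refl = ≡.cong suc (E.inverseˡ {i , p} ≡.refl)
    invʳ : ∀ {x} {y} → proj₁ y ≡ proj₁ (to x) → from y ≡ x
    invʳ {zero} {zero , _} eq = ≡.refl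
    invʳ {suc i} {suc j , q} eq = ≡.cong suc (E.inverseʳ {i} {j , q} (Finₚ.suc-injective eq))

module Finite {n : ℕ} {S : Setoid a ℓ} (finite : HasCardinality n S) where
  open Setoid S
  private module I = Inverse finite

  infix 4 _≟_

  _≟_ : B.Decidable _≈_
  x ≟ y = map′ (λ eq → trans (sym (I.inverseˡ ≡.refl)) (I.inverseˡ eq)) I.from-cong
               (I.from x Finₚ.≟ I.from y)

  all? : {P : Pred Carrier p} → P Respects _≈_ → (∀ x → Dec (P x)) → Dec (∀ x → P x)
  all? resp P? = map′ (λ h x → resp (I.inverseˡ ≡.refl) (h (I.from x))) (λ h i → h (I.to i))
                      (Finₚ.all? (P? ∘ I.to))

  any? : {P : Pred Carrier p} → P Respects _≈_ → (∀ x → Dec (P x)) → Dec (∃ P)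
  any? resp P? = map′ (λ (i , p) → I.to i , p)
                      (λ (x , p) → I.from x , resp (sym (I.inverseˡ ≡.refl)) p)
                      (Finₚ.any? (P? ∘ I.to))

  sub-cardinality : {P : Pred Carrier p} → P Respects _≈_ → (∀ x → Dec (P x)) →
                    ∃[ k ] HasCardinality k (Subsetoid S P)
  sub-cardinality {P = P} resp P? = k , record
    { to = λ i → I.to (proj₁ (E.to i)) , proj₂ (E.to i)
    ; from = λ x → E.from (back x)
    ; to-cong = λ { ≡.refl → refl }
    ; from-cong = λ {x} {y} eq → E.from-cong {back x} {back y} (I.from-cong eq)
    ; inverse = (λ {x} eq → I.inverseˡ (E.inverseˡ {back x} eq))
              , (λ {i} {y} eq → E.inverseʳ {i} {back y} (I.inverseʳ eq))
    }
    where
    counted = subFin n (P? ∘ I.to)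
    k = proj₁ counted
    module E = Inverse (proj₂ counted)
    back : Σ Carrier P → Σ (Fin n) (P ∘ I.to)
    back (x , p) = I.from x , resp (sym (I.inverseˡ ≡.refl)) p

record IsField (R : Ring a ℓ) : Set (a ⊔ ℓ) where
  open Ring R using (Carrier; _≈_; 0#; 1#) renaming (_*_ to _·_)
  field
    *-comm  : ∀ x y → x · y ≈ y · x
    1≉0     : ¬ (1# ≈ 0#)
    inverse : ∀ x → ¬ (x ≈ 0#) → ∃[ y ] x · y ≈ 1#

record IsCarmichaelRing (R : Ring a ℓ) : Set (a ⊔ ℓ) where
  open Ring R using (Carrier; _≈_; setoid; semiring)
  open Exp semiring using () renaming (_^_ to _^ᴿ_)
  field
    order    : ℕ
    finite   : HasCardinality order setoid
    ¬field   : ¬ IsField R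
    fermat   : ∀ x → x ^ᴿ order ≈ x

record FiniteField (a ℓ : Level) (q : ℕ) : Set (lsuc (a ⊔ ℓ)) where
  field
    ring    : Ring a ℓ
    isField : IsField ring
    finite  : HasCardinality q (Ring.setoid ring)

  commutativeRing : CommutativeRing a ℓ
  commutativeRing = record
    { isCommutativeRing = record
      { isRing = Ring.isRing ring
      ; *-comm = IsField.*-comm isField
      }
    }

module _ (R : Ring a ℓ) {n : ℕ} (card : HasCardinality n (Ring.setoid R)) where
  open Ring R renaming (_*_ to _·_; _+_ to _⊕_)
  open Finite card

  isField? : Dec (IsField R)
  isField? = map′
    (λ (comm , one , inv) → record { *-comm = comm ; 1≉0 = one ; inverse = inv })
    (λ F → let open IsField F in *-comm , 1≉0 , inverse)
    (all? (λ eq h y → trans (*-congʳ (sym eq)) (trans (h y) (*-congˡ eq)))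
       (λ x → all? (λ eq h → trans (*-congˡ (sym eq)) (trans h (*-congʳ eq)))
         (λ y → x · y ≟ y · x))
     ×-dec ¬? (1# ≟ 0#)
     ×-dec all? (λ eq h ne → let (y , e) = h (ne ∘ trans (sym eq)) in y , trans (*-congʳ (sym eq)) e)
       (λ x → ¬? (x ≟ 0#) →-dec any? (λ eq h → trans (*-congˡ (sym eq)) h) (λ y → x · y ≟ 1#)))

  isCarmichaelRing? : Dec (IsCarmichaelRing R)
  isCarmichaelRing? = map′
    (λ (nf , h) → record { order = n ; finite = card ; ¬field = nf ; fermat = h })
    (λ C → let open IsCarmichaelRing C in ¬field , λ x →
       trans (Exp.^-congʳ semiring x (cardinality-unique {S = setoid} card (IsCarmichaelRing.finite C))) (fermat x))
    (¬? isField? ×-dec all? (λ eq h → trans (Exp.^-congˡ semiring n (sym eq)) (trans h eq))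
       (λ x → x ^ᴿ n ≟ x))
    where open Exp semiring using () renaming (_^_ to _^ᴿ_)

module PrincipalQuotient (R : CommutativeRing a ℓ) (f : CommutativeRing.Carrier R) where
  open CommutativeRing R renaming (_*_ to _·_; _+_ to _⊕_)
  open Divisibility semiring using (_∣_) renaming (_,_ to divides)
  open RingProperties ring
  open SetoidReasoning setoid

  infix 4 _~_

  record _~_ (x y : Carrier) : Set (a ⊔ ℓ) where
    constructor mod
    field f∣x-y : f ∣ (x - y)

  private
    via : ∀ {x y} q → x ≈ y ⊕ q · f → x ~ y
    via {x} {y} q eq = mod (divides q (sym (begin
      x ⊕ - y               ≈⟨ +-congʳ eq ⟩
      (y ⊕ q · f) ⊕ - y     ≈⟨ +-congʳ (+-comm y _) ⟩
      (q · f ⊕ y) ⊕ - y     ≈⟨ +-assoc _ _ _ ⟩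
      q · f ⊕ (y ⊕ - y)     ≈⟨ +-congˡ (-‿inverseʳ y) ⟩
      q · f ⊕ 0#            ≈⟨ +-identityʳ _ ⟩
      q · f                 ∎)))

    out : ∀ {x y} → x ~ y → ∃[ q ] x ≈ y ⊕ q · f
    out {x} {y} (mod (divides q eq)) = q , sym (begin
      y ⊕ q · f      ≈⟨ +-congˡ eq ⟩
      y ⊕ (x ⊕ - y)  ≈⟨ +-comm y _ ⟩
      (x ⊕ - y) ⊕ y  ≈⟨ +-assoc _ _ _ ⟩
      x ⊕ (- y ⊕ y)  ≈⟨ +-congˡ (-‿inverseˡ y) ⟩
      x ⊕ 0#         ≈⟨ +-identityʳ x ⟩
      x              ∎)

  ≈⇒~ : ∀ {x y} → x ≈ y → x ~ y
  ≈⇒~ {x} {y} eq = via 0# (trans eq (sym (trans (+-congˡ (zeroˡ f)) (+-identityʳ y))))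

  ~-sym : ∀ {x y} → x ~ y → y ~ x
  ~-sym {x} {y} e with q , eq ← out e = via (- q) (begin
    y                          ≈⟨ +-identityʳ y ⟨
    y ⊕ 0#                     ≈⟨ +-congˡ (-‿inverseʳ _) ⟨
    y ⊕ (q · f ⊕ - (q · f))    ≈⟨ +-assoc _ _ _ ⟨
    (y ⊕ q · f) ⊕ - (q · f)    ≈⟨ +-cong eq (sym (-‿distribˡ-* q f)) ⟨
    x ⊕ - q · f                ∎)

  ~-trans : ∀ {x y z} → x ~ y → y ~ z → x ~ z
  ~-trans {x} {y} {z} e e′ with q , eq ← out e | r , eq′ ← out e′ = via (r ⊕ q) (begin
    x                      ≈⟨ eq ⟩
    y ⊕ q · f              ≈⟨ +-congʳ eq′ ⟩
    (z ⊕ r · f) ⊕ q · f    ≈⟨ +-assoc _ _ _ ⟩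
    z ⊕ (r · f ⊕ q · f)    ≈⟨ +-congˡ (distribʳ f r q) ⟨
    z ⊕ (r ⊕ q) · f        ∎)

  +-cong~ : ∀ {x y u v} → x ~ y → u ~ v → x ⊕ u ~ y ⊕ v
  +-cong~ {x} {y} {u} {v} e e′ with q , eq ← out e | r , eq′ ← out e′ = via (q ⊕ r) (begin
    x ⊕ u                          ≈⟨ +-cong eq eq′ ⟩
    (y ⊕ q · f) ⊕ (v ⊕ r · f)      ≈⟨ +-assoc _ _ _ ⟩
    y ⊕ (q · f ⊕ (v ⊕ r · f))      ≈⟨ +-congˡ (+-assoc _ _ _) ⟨
    y ⊕ ((q · f ⊕ v) ⊕ r · f)      ≈⟨ +-congˡ (+-congʳ (+-comm _ _)) ⟩
    y ⊕ ((v ⊕ q · f) ⊕ r · f)      ≈⟨ +-congˡ (+-assoc _ _ _) ⟩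
    y ⊕ (v ⊕ (q · f ⊕ r · f))      ≈⟨ +-assoc _ _ _ ⟨
    (y ⊕ v) ⊕ (q · f ⊕ r · f)      ≈⟨ +-congˡ (distribʳ f q r) ⟨
    (y ⊕ v) ⊕ (q ⊕ r) · f          ∎)

  -‿cong~ : ∀ {x y} → x ~ y → - x ~ - y
  -‿cong~ {x} {y} e with q , eq ← out e = via (- q) (begin
    - x                  ≈⟨ -‿cong eq ⟩
    - (y ⊕ q · f)        ≈⟨ -‿+-comm y (q · f) ⟨
    - y ⊕ - (q · f)      ≈⟨ +-congˡ (-‿distribˡ-* q f) ⟩
    - y ⊕ - q · f        ∎)

  *-congˡ~ : ∀ z {x y} → x ~ y → z · x ~ z · y
  *-congˡ~ z {x} {y} e with q , eq ← out e = via (z · q) (begin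
    z · x                 ≈⟨ *-congˡ eq ⟩
    z · (y ⊕ q · f)       ≈⟨ distribˡ z y _ ⟩
    z · y ⊕ z · (q · f)   ≈⟨ +-congˡ (*-assoc z q f) ⟨
    z · y ⊕ z · q · f     ∎)

  *-cong~ : ∀ {x y u v} → x ~ y → u ~ v → x · u ~ y · v
  *-cong~ {x} {y} {u} {v} e e′ =
    ~-trans (≈⇒~ (*-comm x u)) (~-trans (*-congˡ~ u e) (~-trans (≈⇒~ (*-comm u y)) (*-congˡ~ y e′)))

  quotientRing : Ring a (a ⊔ ℓ)
  quotientRing = record
    { Carrier = Carrier
    ; _≈_ = _~_
    ; _+_ = _⊕_
    ; _*_ = _·_
    ; -_ = -_
    ; 0# = 0#
    ; 1# = 1#
    ; isRing = record
      { +-isAbelianGroup = record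
        { isGroup = record
          { isMonoid = record
            { isSemigroup = record
              { isMagma = record
                { isEquivalence = record { refl = ≈⇒~ refl ; sym = ~-sym ; trans = ~-trans }
                ; ∙-cong = +-cong~
                }
              ; assoc = λ x y z → ≈⇒~ (+-assoc x y z)
              }
            ; identity = (λ x → ≈⇒~ (+-identityˡ x)) , (λ x → ≈⇒~ (+-identityʳ x))
            }
          ; inverse = (λ x → ≈⇒~ (-‿inverseˡ x)) , (λ x → ≈⇒~ (-‿inverseʳ x))
          ; ⁻¹-cong = -‿cong~
          }
        ; comm = λ x y → ≈⇒~ (+-comm x y)
        }
      ; *-cong = *-cong~
      ; *-assoc = λ x y z → ≈⇒~ (*-assoc x y z)
      ; *-identity = (λ x → ≈⇒~ (*-identityˡ x)) , (λ x → ≈⇒~ (*-identityʳ x))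
      ; distrib = (λ x y z → ≈⇒~ (distribˡ x y z)) , (λ x y z → ≈⇒~ (distribʳ x y z))
      }
    }

-- A polynomial is the list of its coefficients, constant term first.
-- Trailing zeros are allowed; _≋_ compares coefficients and so ignores them.

module Polynomial (K : CommutativeRing a ℓ) where
  open CommutativeRing K hiding (zero) renaming (Carrier to A; _*_ to _·_; _+_ to _⊕_)
  open RingProperties ring
  private module K = SetoidReasoning setoid

  Poly : Set a
  Poly = List A

  coeff : Poly → ℕ → A
  coeff []      i       = 0#
  coeff (x ∷ p) zero    = x
  coeff (x ∷ p) (suc i) = coeff p i

  infix 4 _≋_

  record _≋_ (p q : Poly) : Set ℓ where
    constructor ≋-intro
    field coeff-≈ : ∀ i → coeff p i ≈ coeff q i

  open _≋_ public

  infixl 6 _+ₚ_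
  infixl 7 _∙ₚ_ _*ₚ_

  _+ₚ_ : Poly → Poly → Poly
  []      +ₚ q       = q
  (x ∷ p) +ₚ []      = x ∷ p
  (x ∷ p) +ₚ (y ∷ q) = x ⊕ y ∷ p +ₚ q

  -ₚ_ : Poly → Poly
  -ₚ p = map (λ x → - x) p

  _∙ₚ_ : A → Poly → Poly
  x ∙ₚ p = map (x ·_) p

  _*ₚ_ : Poly → Poly → Poly
  []      *ₚ q = []
  (x ∷ p) *ₚ q = x ∙ₚ q +ₚ (0# ∷ p *ₚ q)

  1ₚ : Poly
  1ₚ = 1# ∷ []

  coeff-+ : ∀ p q i → coeff (p +ₚ q) i ≈ coeff p i ⊕ coeff q i
  coeff-+ []      q       i       = sym (+-identityˡ _)
  coeff-+ (x ∷ p) []      i       = sym (+-identityʳ _)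
  coeff-+ (x ∷ p) (y ∷ q) zero    = refl
  coeff-+ (x ∷ p) (y ∷ q) (suc i) = coeff-+ p q i

  coeff-neg : ∀ p i → coeff (-ₚ p) i ≈ - coeff p i
  coeff-neg []      i       = sym -0#≈0#
  coeff-neg (x ∷ p) zero    = refl
  coeff-neg (x ∷ p) (suc i) = coeff-neg p i

  coeff-∙ : ∀ x p i → coeff (x ∙ₚ p) i ≈ x · coeff p i
  coeff-∙ x []      i       = sym (zeroʳ x)
  coeff-∙ x (y ∷ p) zero    = refl
  coeff-∙ x (y ∷ p) (suc i) = coeff-∙ x p i

  ≋-refl : ∀ {p} → p ≋ p
  ≋-refl = ≋-intro λ i → refl

  ≋-sym : ∀ {p q} → p ≋ q → q ≋ p
  ≋-sym e = ≋-intro λ i → sym (coeff-≈ e i)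

  ≋-trans : ∀ {p q r} → p ≋ q → q ≋ r → p ≋ r
  ≋-trans e f = ≋-intro λ i → trans (coeff-≈ e i) (coeff-≈ f i)

  polySetoid : Setoid a ℓ
  polySetoid = record
    { Carrier = Poly ; _≈_ = _≋_
    ; isEquivalence = record { refl = ≋-refl ; sym = ≋-sym ; trans = ≋-trans } }

  private module P = SetoidReasoning polySetoid

  ∷-cong : ∀ {x y p q} → x ≈ y → p ≋ q → x ∷ p ≋ y ∷ q
  ∷-cong e f = ≋-intro λ { zero → e ; (suc i) → coeff-≈ f i }

  0∷[] : 0# ∷ [] ≋ []
  0∷[] = ≋-intro λ { zero → refl ; (suc i) → refl }

  +ₚ-cong : ∀ {p q r s} → p ≋ q → r ≋ s → p +ₚ r ≋ q +ₚ s
  +ₚ-cong {p} {q} {r} {s} e f = ≋-intro λ i →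
    trans (coeff-+ p r i) (trans (+-cong (coeff-≈ e i) (coeff-≈ f i)) (sym (coeff-+ q s i)))

  +ₚ-comm : ∀ p q → p +ₚ q ≋ q +ₚ p
  +ₚ-comm p q = ≋-intro λ i →
    trans (coeff-+ p q i) (trans (+-comm _ _) (sym (coeff-+ q p i)))

  +ₚ-assoc : ∀ p q r → (p +ₚ q) +ₚ r ≋ p +ₚ (q +ₚ r)
  +ₚ-assoc p q r = ≋-intro λ i → K.begin
    coeff (p +ₚ q +ₚ r) i                 K.≈⟨ coeff-+ (p +ₚ q) r i ⟩
    coeff (p +ₚ q) i ⊕ coeff r i          K.≈⟨ +-congʳ (coeff-+ p q i) ⟩
    (coeff p i ⊕ coeff q i) ⊕ coeff r i   K.≈⟨ +-assoc _ _ _ ⟩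
    coeff p i ⊕ (coeff q i ⊕ coeff r i)   K.≈⟨ +-congˡ (coeff-+ q r i) ⟨
    coeff p i ⊕ coeff (q +ₚ r) i          K.≈⟨ coeff-+ p (q +ₚ r) i ⟨
    coeff (p +ₚ (q +ₚ r)) i               K.∎

  +ₚ-identityʳ : ∀ p → p +ₚ [] ≋ p
  +ₚ-identityʳ p = +ₚ-comm p []

  -ₚ-cong : ∀ {p q} → p ≋ q → -ₚ p ≋ -ₚ q
  -ₚ-cong {p} {q} e = ≋-intro λ i →
    trans (coeff-neg p i) (trans (-‿cong (coeff-≈ e i)) (sym (coeff-neg q i)))

  -ₚ-inverseʳ : ∀ p → p +ₚ -ₚ p ≋ []
  -ₚ-inverseʳ p = ≋-intro λ i →
    trans (coeff-+ p (-ₚ p) i) (trans (+-congˡ (coeff-neg p i)) (-‿inverseʳ _))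

  +ₚ-interchange : ∀ p q r s → (p +ₚ q) +ₚ (r +ₚ s) ≋ (p +ₚ r) +ₚ (q +ₚ s)
  +ₚ-interchange p q r s = P.begin
    (p +ₚ q) +ₚ (r +ₚ s)  P.≈⟨ +ₚ-assoc p q (r +ₚ s) ⟩
    p +ₚ (q +ₚ (r +ₚ s))  P.≈⟨ +ₚ-cong (≋-refl {p}) (+ₚ-assoc q r s) ⟨
    p +ₚ ((q +ₚ r) +ₚ s)  P.≈⟨ +ₚ-cong (≋-refl {p}) (+ₚ-cong (+ₚ-comm q r) (≋-refl {s})) ⟩
    p +ₚ ((r +ₚ q) +ₚ s)  P.≈⟨ +ₚ-cong (≋-refl {p}) (+ₚ-assoc r q s) ⟩
    p +ₚ (r +ₚ (q +ₚ s))  P.≈⟨ +ₚ-assoc p r (q +ₚ s) ⟨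
    (p +ₚ r) +ₚ (q +ₚ s)  P.∎

  ∙ₚ-cong : ∀ {x y p q} → x ≈ y → p ≋ q → x ∙ₚ p ≋ y ∙ₚ q
  ∙ₚ-cong {x} {y} {p} {q} e f = ≋-intro λ i →
    trans (coeff-∙ x p i) (trans (*-cong e (coeff-≈ f i)) (sym (coeff-∙ y q i)))

  ∙ₚ-distribˡ : ∀ x p q → x ∙ₚ (p +ₚ q) ≋ x ∙ₚ p +ₚ x ∙ₚ q
  ∙ₚ-distribˡ x p q = ≋-intro λ i → K.begin
    coeff (x ∙ₚ (p +ₚ q)) i                 K.≈⟨ coeff-∙ x (p +ₚ q) i ⟩
    x · coeff (p +ₚ q) i                    K.≈⟨ *-congˡ (coeff-+ p q i) ⟩
    x · (coeff p i ⊕ coeff q i)             K.≈⟨ distribˡ x _ _ ⟩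
    x · coeff p i ⊕ x · coeff q i           K.≈⟨ +-cong (coeff-∙ x p i) (coeff-∙ x q i) ⟨
    coeff (x ∙ₚ p) i ⊕ coeff (x ∙ₚ q) i     K.≈⟨ coeff-+ (x ∙ₚ p) (x ∙ₚ q) i ⟨
    coeff (x ∙ₚ p +ₚ x ∙ₚ q) i              K.∎

  ∙ₚ-assoc : ∀ x y p → (x · y) ∙ₚ p ≋ x ∙ₚ (y ∙ₚ p)
  ∙ₚ-assoc x y p = ≋-intro λ i → K.begin
    coeff ((x · y) ∙ₚ p) i    K.≈⟨ coeff-∙ (x · y) p i ⟩
    (x · y) · coeff p i       K.≈⟨ *-assoc x y _ ⟩
    x · (y · coeff p i)       K.≈⟨ *-congˡ (coeff-∙ y p i) ⟨
    x · coeff (y ∙ₚ p) i      K.≈⟨ coeff-∙ x (y ∙ₚ p) i ⟨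
    coeff (x ∙ₚ (y ∙ₚ p)) i   K.∎

  0∙ₚ : ∀ p → 0# ∙ₚ p ≋ []
  0∙ₚ p = ≋-intro λ i → trans (coeff-∙ 0# p i) (zeroˡ _)

  1∙ₚ : ∀ p → 1# ∙ₚ p ≋ p
  1∙ₚ p = ≋-intro λ i → trans (coeff-∙ 1# p i) (*-identityˡ _)

  *ₚ-congˡ : ∀ p {q r} → q ≋ r → p *ₚ q ≋ p *ₚ r
  *ₚ-congˡ []      e = ≋-refl
  *ₚ-congˡ (x ∷ p) e = +ₚ-cong (∙ₚ-cong refl e) (∷-cong refl (*ₚ-congˡ p e))

  *ₚ-zeroʳ : ∀ p → p *ₚ [] ≋ []
  *ₚ-zeroʳ []      = ≋-refl
  *ₚ-zeroʳ (x ∷ p) = ≋-trans (∷-cong refl (*ₚ-zeroʳ p)) 0∷[]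

  *ₚ-∷ : ∀ p x q → p *ₚ (x ∷ q) ≋ x ∙ₚ p +ₚ (0# ∷ p *ₚ q)
  *ₚ-∷ []      x q = ≋-sym 0∷[]
  *ₚ-∷ (y ∷ p) x q = ∷-cong (+-congʳ (*-comm y x)) (P.begin
    y ∙ₚ q +ₚ p *ₚ (x ∷ q)                  P.≈⟨ +ₚ-cong (≋-refl {y ∙ₚ q}) (*ₚ-∷ p x q) ⟩
    y ∙ₚ q +ₚ (x ∙ₚ p +ₚ (0# ∷ p *ₚ q))     P.≈⟨ +ₚ-assoc (y ∙ₚ q) (x ∙ₚ p) _ ⟨
    (y ∙ₚ q +ₚ x ∙ₚ p) +ₚ (0# ∷ p *ₚ q)     P.≈⟨ +ₚ-cong (+ₚ-comm (y ∙ₚ q) (x ∙ₚ p)) ≋-refl ⟩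
    (x ∙ₚ p +ₚ y ∙ₚ q) +ₚ (0# ∷ p *ₚ q)     P.≈⟨ +ₚ-assoc (x ∙ₚ p) (y ∙ₚ q) _ ⟩
    x ∙ₚ p +ₚ (y ∙ₚ q +ₚ (0# ∷ p *ₚ q))     P.∎)

  *ₚ-comm : ∀ p q → p *ₚ q ≋ q *ₚ p
  *ₚ-comm []      q = ≋-sym (*ₚ-zeroʳ q)
  *ₚ-comm (x ∷ p) q = ≋-trans
    (+ₚ-cong (≋-refl {x ∙ₚ q}) (∷-cong refl (*ₚ-comm p q))) (≋-sym (*ₚ-∷ q x p))

  *ₚ-cong : ∀ {p q r s} → p ≋ q → r ≋ s → p *ₚ r ≋ q *ₚ s
  *ₚ-cong {p} {q} {r} {s} e f = P.begin
    p *ₚ r  P.≈⟨ *ₚ-congˡ p f ⟩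
    p *ₚ s  P.≈⟨ *ₚ-comm p s ⟩
    s *ₚ p  P.≈⟨ *ₚ-congˡ s e ⟩
    s *ₚ q  P.≈⟨ *ₚ-comm s q ⟩
    q *ₚ s  P.∎

  *ₚ-distribˡ : ∀ p q r → p *ₚ (q +ₚ r) ≋ p *ₚ q +ₚ p *ₚ r
  *ₚ-distribˡ []      q r = ≋-refl
  *ₚ-distribˡ (x ∷ p) q r = P.begin
    x ∙ₚ (q +ₚ r) +ₚ (0# ∷ p *ₚ (q +ₚ r))
      P.≈⟨ +ₚ-cong (∙ₚ-distribˡ x q r) (∷-cong (sym (+-identityʳ 0#)) (*ₚ-distribˡ p q r)) ⟩
    (x ∙ₚ q +ₚ x ∙ₚ r) +ₚ ((0# ∷ p *ₚ q) +ₚ (0# ∷ p *ₚ r))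
      P.≈⟨ +ₚ-interchange (x ∙ₚ q) (x ∙ₚ r) (0# ∷ p *ₚ q) (0# ∷ p *ₚ r) ⟩
    (x ∙ₚ q +ₚ (0# ∷ p *ₚ q)) +ₚ (x ∙ₚ r +ₚ (0# ∷ p *ₚ r)) P.∎

  *ₚ-distribʳ : ∀ p q r → (q +ₚ r) *ₚ p ≋ q *ₚ p +ₚ r *ₚ p
  *ₚ-distribʳ p q r = P.begin
    (q +ₚ r) *ₚ p       P.≈⟨ *ₚ-comm (q +ₚ r) p ⟩
    p *ₚ (q +ₚ r)       P.≈⟨ *ₚ-distribˡ p q r ⟩
    p *ₚ q +ₚ p *ₚ r    P.≈⟨ +ₚ-cong (*ₚ-comm p q) (*ₚ-comm p r) ⟩
    q *ₚ p +ₚ r *ₚ p    P.∎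

  0∷-*ₚ : ∀ p q → (0# ∷ p) *ₚ q ≋ 0# ∷ p *ₚ q
  0∷-*ₚ p q = +ₚ-cong (0∙ₚ q) ≋-refl

  ∙ₚ-*ₚ : ∀ x p q → (x ∙ₚ p) *ₚ q ≋ x ∙ₚ (p *ₚ q)
  ∙ₚ-*ₚ x []      q = ≋-refl
  ∙ₚ-*ₚ x (y ∷ p) q = P.begin
    (x · y) ∙ₚ q +ₚ (0# ∷ (x ∙ₚ p) *ₚ q)
      P.≈⟨ +ₚ-cong (∙ₚ-assoc x y q) (∷-cong (sym (zeroʳ x)) (∙ₚ-*ₚ x p q)) ⟩
    x ∙ₚ (y ∙ₚ q) +ₚ x ∙ₚ (0# ∷ p *ₚ q)
      P.≈⟨ ∙ₚ-distribˡ x (y ∙ₚ q) (0# ∷ p *ₚ q) ⟨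
    x ∙ₚ (y ∙ₚ q +ₚ (0# ∷ p *ₚ q)) P.∎

  *ₚ-assoc : ∀ p q r → (p *ₚ q) *ₚ r ≋ p *ₚ (q *ₚ r)
  *ₚ-assoc []      q r = ≋-refl
  *ₚ-assoc (x ∷ p) q r = P.begin
    (x ∙ₚ q +ₚ (0# ∷ p *ₚ q)) *ₚ r
      P.≈⟨ *ₚ-distribʳ r (x ∙ₚ q) (0# ∷ p *ₚ q) ⟩
    (x ∙ₚ q) *ₚ r +ₚ (0# ∷ p *ₚ q) *ₚ r
      P.≈⟨ +ₚ-cong (∙ₚ-*ₚ x q r) (≋-trans (0∷-*ₚ (p *ₚ q) r) (∷-cong refl (*ₚ-assoc p q r))) ⟩
    x ∙ₚ (q *ₚ r) +ₚ (0# ∷ p *ₚ (q *ₚ r)) P.∎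

  *ₚ-identityˡ : ∀ p → 1ₚ *ₚ p ≋ p
  *ₚ-identityˡ p = ≋-trans (+ₚ-cong (1∙ₚ p) 0∷[]) (+ₚ-identityʳ p)

  polynomialRing : CommutativeRing a ℓ
  polynomialRing = record
    { Carrier = Poly
    ; _≈_ = _≋_
    ; _+_ = _+ₚ_
    ; _*_ = _*ₚ_
    ; -_ = -ₚ_
    ; 0# = []
    ; 1# = 1ₚ
    ; isCommutativeRing = record
      { isRing = record
        { +-isAbelianGroup = record
          { isGroup = record
            { isMonoid = record
              { isSemigroup = record
                { isMagma = record
                  { isEquivalence = Setoid.isEquivalence polySetoid
                  ; ∙-cong = +ₚ-cong
                  }
                ; assoc = +ₚ-assoc
                }
              ; identity = (λ p → ≋-refl) , +ₚ-identityʳ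
              }
            ; inverse = (λ p → ≋-trans (+ₚ-comm (-ₚ p) p) (-ₚ-inverseʳ p)) , -ₚ-inverseʳ
            ; ⁻¹-cong = -ₚ-cong
            }
          ; comm = +ₚ-comm
          }
        ; *-cong = *ₚ-cong
        ; *-assoc = *ₚ-assoc
        ; *-identity = *ₚ-identityˡ , λ p → ≋-trans (*ₚ-comm p 1ₚ) (*ₚ-identityˡ p)
        ; distrib = *ₚ-distribˡ , *ₚ-distribʳ
        }
      ; *-comm = *ₚ-comm
      }
    }

  -- n is the degree of p when 1# is not 0#.
  IsMonic : ℕ → Poly → Set ℓ
  IsMonic n p = coeff p n ≈ 1# × (∀ i → i > n → coeff p i ≈ 0#)

  K[t]/⟨_⟩ : Poly → Ring a (a ⊔ ℓ)
  K[t]/⟨ f ⟩ = PrincipalQuotient.quotientRing polynomialRing f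

  IsCarmichael : Poly → Set (a ⊔ ℓ)
  IsCarmichael f = IsCarmichaelRing K[t]/⟨ f ⟩

  LowDegree : ℕ → Poly → Set ℓ
  LowDegree n p = ∀ i → i ≥ n → coeff p i ≈ 0#

  coeff-sub : ∀ p q i → coeff (p +ₚ -ₚ q) i ≈ coeff p i - coeff q i
  coeff-sub p q i = trans (coeff-+ p (-ₚ q) i) (+-congˡ (coeff-neg q i))

  sub-low : ∀ {n p q} → LowDegree n p → LowDegree n q → LowDegree n (p +ₚ -ₚ q)
  sub-low {n} {p} {q} hp hq i i≥n = K.begin
    coeff (p +ₚ -ₚ q) i    K.≈⟨ coeff-sub p q i ⟩
    coeff p i - coeff q i  K.≈⟨ +-cong (hp i i≥n) (-‿cong (hq i i≥n)) ⟩
    0# - 0#                K.≈⟨ -‿inverseʳ 0# ⟩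
    0#                     K.∎

  sub≋[]⇒≋ : ∀ p q → p +ₚ -ₚ q ≋ [] → p ≋ q
  sub≋[]⇒≋ p q e = ≋-intro λ i → x∙y⁻¹≈ε⇒x≈y _ _ (trans (sym (coeff-sub p q i)) (coeff-≈ e i))

  module Division {n : ℕ} {f : Poly} (f-monic : IsMonic n f) where
    open PrincipalQuotient polynomialRing f
    open Divisibility (CommutativeRing.semiring polynomialRing) using () renaming (_,_ to divides)

    step : A → Poly → Poly
    step x r = (x ∷ r) +ₚ -ₚ (coeff (x ∷ r) n ∙ₚ f)

    remainder : Poly → Poly
    remainder []      = []
    remainder (x ∷ p) = step x (remainder p)

    remainder-low : ∀ p → LowDegree n (remainder p)
    remainder-low []      i i≥n = refl
    remainder-low (x ∷ p) i i≥n = K.begin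
      coeff (step x r) i                            K.≈⟨ coeff-sub (x ∷ r) (c ∙ₚ f) i ⟩
      coeff (x ∷ r) i - coeff (c ∙ₚ f) i            K.≈⟨ +-congˡ (-‿cong (coeff-∙ c f i)) ⟩
      coeff (x ∷ r) i - c · coeff f i               K.≈⟨ cancel i i≥n ⟩
      0#                                            K.∎
      where
      r = remainder p
      c = coeff (x ∷ r) n
      above : ∀ i → i > n → coeff (x ∷ r) i ≈ 0#
      above (suc i) (s≤s i≥n) = remainder-low p i i≥n
      cancel : ∀ i → i ≥ n → coeff (x ∷ r) i - c · coeff f i ≈ 0#
      cancel i i≥n with ℕₚ.m≤n⇒m<n∨m≡n i≥n
      ... | inj₂ ≡.refl = trans (+-congˡ (-‿cong (trans (*-congˡ (proj₁ f-monic)) (*-identityʳ c)))) (-‿inverseʳ c)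
      ... | inj₁ i>n = trans (+-cong (above i i>n) (-‿cong (trans (*-congˡ (proj₂ f-monic i i>n)) (zeroʳ c))))
                             (-‿inverseʳ 0#)

    remainder-~ : ∀ p → remainder p ~ p
    remainder-~ []      = ≈⇒~ ≋-refl
    remainder-~ (x ∷ p) = ~-trans (+-cong~ {x ∷ r} {x ∷ p} shifted (-‿cong~ c∙f~0))
                                  (≈⇒~ (+ₚ-identityʳ (x ∷ p)))
      where
      r = remainder p
      c = coeff (x ∷ r) n
      c∙f~0 : c ∙ₚ f ~ []
      c∙f~0 = mod (divides (c ∷ []) (≋-trans (≋-trans (+ₚ-cong (≋-refl {c ∙ₚ f}) 0∷[]) (+ₚ-identityʳ _))
                                             (≋-sym (+ₚ-identityʳ (c ∙ₚ f)))))
      -- x ∷ p is x + t p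
      split : ∀ s → x ∷ s ≋ (x ∷ []) +ₚ (0# ∷ 1# ∷ []) *ₚ s
      split s = ≋-sym (≋-trans (+ₚ-cong (≋-refl {x ∷ []}) (≋-trans (0∷-*ₚ 1ₚ s) (∷-cong refl (*ₚ-identityˡ s))))
                               (∷-cong (+-identityʳ x) ≋-refl))
      shifted : x ∷ r ~ x ∷ p
      shifted = ~-trans (≈⇒~ (split r)) (~-trans
        (+-cong~ {x ∷ []} (≈⇒~ ≋-refl) (*-congˡ~ (0# ∷ 1# ∷ []) (remainder-~ p)))
        (≈⇒~ (≋-sym (split p))))

    low-multiple : ∀ h → LowDegree n (h *ₚ f) → h ≋ []
    low-multiple []      low = ≋-refl
    low-multiple (x ∷ h) low = ≋-trans (∷-cong x≈0 h≋0) 0∷[]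
      where
      h*f-low : LowDegree n (h *ₚ f)
      h*f-low i i≥n = K.begin
        coeff (h *ₚ f) i                                    K.≈⟨ +-identityˡ _ ⟨
        0# ⊕ coeff (h *ₚ f) i
          K.≈⟨ +-congʳ (trans (*-congˡ (proj₂ f-monic (suc i) (s≤s i≥n))) (zeroʳ x)) ⟨
        x · coeff f (suc i) ⊕ coeff (h *ₚ f) i              K.≈⟨ +-congʳ (coeff-∙ x f (suc i)) ⟨
        coeff (x ∙ₚ f) (suc i) ⊕ coeff (h *ₚ f) i           K.≈⟨ coeff-+ (x ∙ₚ f) (0# ∷ h *ₚ f) (suc i) ⟨
        coeff ((x ∷ h) *ₚ f) (suc i)                        K.≈⟨ low (suc i) (ℕₚ.m≤n⇒m≤1+n i≥n) ⟩
        0#                                                  K.∎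
      h≋0 = low-multiple h h*f-low
      x≈0 : x ≈ 0#
      x≈0 = K.begin
        x                                                   K.≈⟨ *-identityʳ x ⟨
        x · 1#                                              K.≈⟨ *-congˡ (proj₁ f-monic) ⟨
        x · coeff f n                                       K.≈⟨ coeff-∙ x f n ⟨
        coeff (x ∙ₚ f) n                                    K.≈⟨ +-identityʳ _ ⟨
        coeff (x ∙ₚ f) n ⊕ 0#
          K.≈⟨ +-congˡ (coeff-≈ (≋-trans (∷-cong refl (*ₚ-cong h≋0 ≋-refl)) 0∷[]) n) ⟨
        coeff (x ∙ₚ f) n ⊕ coeff (0# ∷ h *ₚ f) n            K.≈⟨ coeff-+ (x ∙ₚ f) (0# ∷ h *ₚ f) n ⟨
        coeff ((x ∷ h) *ₚ f) n                              K.≈⟨ low n ℕₚ.≤-refl ⟩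
        0#                                                  K.∎

    low-unique : ∀ {p q} → LowDegree n p → LowDegree n q → p ~ q → p ≋ q
    low-unique {p} {q} hp hq (mod (divides h e)) = sub≋[]⇒≋ p q (≋-trans (≋-sym e)
      (*ₚ-cong (low-multiple h (λ i i≥n → trans (coeff-≈ e i) (sub-low {p = p} {q} hp hq i i≥n))) (≋-refl {f})))

    remainders : Inverse (Subsetoid polySetoid (LowDegree n)) (Ring.setoid K[t]/⟨ f ⟩)
    remainders = record
      { to = proj₁
      ; from = λ p → remainder p , remainder-low p
      ; to-cong = ≈⇒~
      ; from-cong = λ {p} {q} e → unique p (remainder-low q) (~-trans e (~-sym (remainder-~ q)))
      ; inverse = (λ {p} e → ~-trans (≈⇒~ e) (remainder-~ p))
                , (λ { {p , low} {q} e → unique q low e })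
      }
      where
      unique : ∀ p {q} → LowDegree n q → p ~ q → remainder p ≋ q
      unique p low e = low-unique (remainder-low p) low (~-trans (remainder-~ p) e)

  coeff-tabulate : ∀ {n} (g : Fin n → A) j → coeff (tabulate g) (toℕ j) ≡ g j
  coeff-tabulate g zero    = ≡.refl
  coeff-tabulate g (suc j) = coeff-tabulate (g ∘ suc) j

  tabulate-low : ∀ {n} (g : Fin n → A) → LowDegree n (tabulate g)
  tabulate-low {zero}  g i       i≥n       = refl
  tabulate-low {suc n} g (suc i) (s≤s i≥n) = tabulate-low (g ∘ suc) i i≥n

  ≋-low : ∀ n {p q} → LowDegree n p → LowDegree n q →
          (∀ (j : Fin n) → coeff p (toℕ j) ≈ coeff q (toℕ j)) → p ≋ q
  ≋-low n {p} {q} hp hq e = ≋-intro eq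
    where
    eq : ∀ i → coeff p i ≈ coeff q i
    eq i with i ℕₚ.<? n
    ... | yes i<n = ≡.subst (λ k → coeff p k ≈ coeff q k) (Finₚ.toℕ-fromℕ< i<n) (e (fromℕ< i<n))
    ... | no i≮n = trans (hp i (ℕₚ.≮⇒≥ i≮n)) (sym (hq i (ℕₚ.≮⇒≥ i≮n)))

  monomial : ℕ → Poly
  monomial zero    = 1ₚ
  monomial (suc n) = 0# ∷ monomial n

  monomial-monic : ∀ n → IsMonic n (monomial n)
  monomial-monic zero    = refl , λ { (suc i) _ → refl }
  monomial-monic (suc n) = proj₁ (monomial-monic n) , λ { (suc i) (s≤s i>n) → proj₂ (monomial-monic n) i i>n }

  Monic : ℕ → Setoid (a ⊔ ℓ) ℓ
  Monic n = Subsetoid polySetoid (IsMonic n)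

  low↔monic : ∀ n → Inverse (Subsetoid polySetoid (LowDegree n)) (Monic n)
  low↔monic n = record
    { to = λ (p , low) → p +ₚ t^n
        , trans (coeff-+ p t^n n) (trans (+-cong (low n ℕₚ.≤-refl) (proj₁ monic)) (+-identityˡ 1#))
        , λ i i>n → trans (coeff-+ p t^n i)
            (trans (+-cong (low i (ℕₚ.<⇒≤ i>n)) (proj₂ monic i i>n)) (+-identityˡ 0#))
    ; from = λ (p , h) → p +ₚ -ₚ t^n , low p h
    ; to-cong = λ e → +ₚ-cong e (≋-refl {t^n})
    ; from-cong = λ e → +ₚ-cong e (≋-refl { -ₚ t^n})
    ; inverse = (λ { {p , _} e → ≋-trans (+ₚ-cong e (≋-refl {t^n})) (down-up p) })
              , (λ { {p , _} e → ≋-trans (+ₚ-cong e (≋-refl { -ₚ t^n})) (up-down p) })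
    }
    where
    t^n = monomial n
    monic = monomial-monic n
    low : ∀ p → IsMonic n p → LowDegree n (p +ₚ -ₚ t^n)
    low p h i i≥n with ℕₚ.m≤n⇒m<n∨m≡n i≥n
    ... | inj₂ ≡.refl = trans (coeff-sub p t^n n) (trans (+-cong (proj₁ h) (-‿cong (proj₁ monic))) (-‿inverseʳ 1#))
    ... | inj₁ i>n = trans (coeff-sub p t^n i)
                       (trans (+-cong (proj₂ h i i>n) (-‿cong (proj₂ monic i i>n))) (-‿inverseʳ 0#))
    up-down : ∀ p → (p +ₚ t^n) +ₚ -ₚ t^n ≋ p
    up-down p = ≋-trans (+ₚ-assoc p t^n (-ₚ t^n))
      (≋-trans (+ₚ-cong (≋-refl {p}) (-ₚ-inverseʳ t^n)) (+ₚ-identityʳ p))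
    down-up : ∀ p → (p +ₚ -ₚ t^n) +ₚ t^n ≋ p
    down-up p = ≋-trans (+ₚ-assoc p (-ₚ t^n) t^n)
      (≋-trans (+ₚ-cong (≋-refl {p}) (≋-trans (+ₚ-comm (-ₚ t^n) t^n) (-ₚ-inverseʳ t^n))) (+ₚ-identityʳ p))

  -- Divisibility by f depends on f only up to _≋_.
  IsCarmichael-resp : IsCarmichael Respects _≋_
  IsCarmichael-resp {f} {g} f≋g C = record
    { order = order
    ; finite = record
      { to = F.to ; from = F.from
      ; to-cong = λ e → fwd (F.to-cong e)
      ; from-cong = λ e → F.from-cong (bwd e)
      ; inverse = (λ e → fwd (F.inverseˡ e)) , (λ e → F.inverseʳ (bwd e))
      }
    ; ¬field = λ G → ¬field (record
      { *-comm = λ x y → bwd (IsField.*-comm G x y)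
      ; 1≉0 = λ e → IsField.1≉0 G (fwd e)
      ; inverse = λ x h → let (y , e) = IsField.inverse G x (λ e → h (bwd e)) in y , bwd e
      })
    ; fermat = λ x → Qg.trans (power x order) (fwd (fermat x))
    }
    where
    open IsCarmichaelRing C
    module F = Inverse finite
    module Qf = Ring K[t]/⟨ f ⟩
    module Qg = Ring K[t]/⟨ g ⟩
    open Divisibility (CommutativeRing.semiring polynomialRing) using (∣ʳ-respˡ-≈)
    fwd : ∀ {x y} → x Qf.≈ y → x Qg.≈ y
    fwd (PrincipalQuotient.mod d) = PrincipalQuotient.mod (∣ʳ-respˡ-≈ f≋g d)
    bwd : ∀ {x y} → x Qg.≈ y → x Qf.≈ y
    bwd (PrincipalQuotient.mod d) = PrincipalQuotient.mod (∣ʳ-respˡ-≈ (≋-sym f≋g) d)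
    open Exp Qf.semiring using () renaming (_^_ to _^f_)
    open Exp Qg.semiring using () renaming (_^_ to _^g_)
    power : ∀ x k → (x ^g k) Qg.≈ (x ^f k)
    power x zero    = Qg.refl
    power x (suc k) = Qg.*-congˡ {x} (power x k)

  module Count {q : ℕ} (finite : HasCardinality q setoid) where
    private module I = Inverse finite

    funToFin-cong : ∀ n {g h : Fin n → Fin q} → (∀ j → g j ≡ h j) → funToFin g ≡ funToFin h
    funToFin-cong zero    e = ≡.refl
    funToFin-cong (suc n) e = ≡.cong₂ combine (e zero) (funToFin-cong n (e ∘ suc))

    low-cardinality : ∀ n → HasCardinality (q ^ n) (Subsetoid polySetoid (LowDegree n))
    low-cardinality n = record
      { to = to ; from = from
      ; to-cong = λ { ≡.refl → ≋-refl }
      ; from-cong = λ {x} {y} → from-cong {x} {y}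
      ; inverse = (λ { {x} ≡.refl → to-from x })
                , (λ { {i} {y} e → ≡.trans (from-cong {y} {to i} e) (from-to i) })
      }
      where
      to : Fin (q ^ n) → Σ Poly (LowDegree n)
      to i = tabulate (I.to ∘ finToFun {q} {n} i) , tabulate-low (I.to ∘ finToFun {q} {n} i)
      from : Σ Poly (LowDegree n) → Fin (q ^ n)
      from (p , _) = funToFin {n} (λ j → I.from (coeff p (toℕ j)))
      from-cong : ∀ {x y} → proj₁ x ≋ proj₁ y → from x ≡ from y
      from-cong e = funToFin-cong n (λ j → I.from-cong (coeff-≈ e (toℕ j)))
      to-from : ∀ x → proj₁ (to (from x)) ≋ proj₁ x
      to-from x@(p , low) = ≋-low n {proj₁ (to (from x))} {p} (proj₂ (to (from x))) low λ j →
        trans (reflexive (coeff-tabulate (I.to ∘ finToFun {q} {n} (from x)) j))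
          (I.inverseˡ (Finₚ.finToFun-funToFin {n} (λ j → I.from (coeff p (toℕ j))) j))
      from-to : ∀ i → from (to i) ≡ i
      from-to i = ≡.trans
        (funToFin-cong n (λ j → I.inverseʳ (reflexive (coeff-tabulate (I.to ∘ finToFun {q} {n} i) j))))
        (Finₚ.funToFin-finToFin {n} {q} i)

    monic-cardinality : ∀ n → HasCardinality (q ^ n) (Monic n)
    monic-cardinality n = Compose.inverse (low-cardinality n) (low↔monic n)

    quotient-cardinality : ∀ {n f} → IsMonic n f → HasCardinality (q ^ n) (Ring.setoid K[t]/⟨ f ⟩)
    quotient-cardinality {n} f-monic = Compose.inverse (low-cardinality n) (Division.remainders f-monic)

    carmichael-cardinality : ∀ n → ∃[ k ] HasCardinality k (Subsetoid (Monic n) (IsCarmichael ∘ proj₁))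
    carmichael-cardinality n = Finite.sub-cardinality (monic-cardinality n)
      {P = IsCarmichael ∘ proj₁} IsCarmichael-resp
      (λ (f , monic) → isCarmichaelRing? K[t]/⟨ f ⟩ (quotient-cardinality monic))

-- The number of monic f of degree n such that F[t]/(f) is a Carmichael ring.
carmichaelCount : ∀ {q} → FiniteField a ℓ q → ℕ → ℕ
carmichaelCount F n = proj₁ (carmichael-cardinality n)
  where
  open FiniteField F
  open Polynomial.Count commutativeRing finite

-- Two-sided Dedekind cuts: lower r is r < x and upper r is x < r.

record ℝ : Set₁ where
  field
    lower upper    : ℚ → Set
    lower-nonempty : ∃ lower
    upper-nonempty : ∃ upper
    lower-open     : ∀ r → lower r ⇔ (∃[ s ] r <ʳ s × lower s)
    upper-open     : ∀ r → upper r ⇔ (∃[ s ] s <ʳ r × upper s)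
    disjoint       : ∀ r → ¬ (lower r × upper r)
    located        : ∀ r s → r <ʳ s → lower r ⊎ upper s

private
  sub-sub : ∀ q r → q -ʳ (q -ʳ r) ≡ r
  sub-sub q r = begin
    q +ʳ -ʳ (q +ʳ -ʳ r)        ≡⟨ ≡.cong (q +ʳ_) (ℚₚ.neg-distrib-+ q (-ʳ r)) ⟩
    q +ʳ (-ʳ q +ʳ -ʳ (-ʳ r))   ≡⟨ ℚₚ.+-assoc q (-ʳ q) (-ʳ (-ʳ r)) ⟨
    (q -ʳ q) +ʳ -ʳ (-ʳ r)      ≡⟨ ≡.cong₂ _+ʳ_ (ℚₚ.+-inverseʳ q) (-ʳ-involutive r) ⟩
    0ℚ +ʳ r                    ≡⟨ ℚₚ.+-identityˡ r ⟩
    r                          ∎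
    where
    open ≡.≡-Reasoning
    -ʳ-involutive : ∀ r → -ʳ (-ʳ r) ≡ r
    -ʳ-involutive = RingProperties.-‿involutive ℚₚ.+-*-ring

  sub-anti : ∀ q {r s} → r <ʳ s → q -ʳ s <ʳ q -ʳ r
  sub-anti q r<s = ℚₚ.+-monoʳ-< q (ℚₚ.neg-antimono-< r<s)

infixl 6 _ℚ-_

_ℚ-_ : ℚ → ℝ → ℝ
q ℚ- x = record
  { lower = λ r → upper (q -ʳ r)
  ; upper = λ r → lower (q -ʳ r)
  ; lower-nonempty = let (r , u) = upper-nonempty in q -ʳ r , ≡.subst upper (≡.sym (sub-sub q r)) u
  ; upper-nonempty = let (r , l) = lower-nonempty in q -ʳ r , ≡.subst lower (≡.sym (sub-sub q r)) l
  ; lower-open = λ r → mk⇔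
      (λ u → let (s , s<q-r , u′) = Equivalence.to (upper-open (q -ʳ r)) u in
        q -ʳ s , ≡.subst (_<ʳ q -ʳ s) (sub-sub q r) (sub-anti q s<q-r)
               , ≡.subst upper (≡.sym (sub-sub q s)) u′)
      (λ (s , r<s , u) → Equivalence.from (upper-open (q -ʳ r)) (q -ʳ s , sub-anti q r<s , u))
  ; upper-open = λ r → mk⇔
      (λ l → let (s , q-r<s , l′) = Equivalence.to (lower-open (q -ʳ r)) l in
        q -ʳ s , ≡.subst (q -ʳ s <ʳ_) (sub-sub q r) (sub-anti q q-r<s)
               , ≡.subst lower (≡.sym (sub-sub q s)) l′)
      (λ (s , s<r , l) → Equivalence.from (lower-open (q -ʳ r)) (q -ʳ s , sub-anti q s<r , l))
  ; disjoint = λ r (u , l) → disjoint (q -ʳ r) (l , u)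
  ; located = λ r s r<s → swap (located (q -ʳ s) (q -ʳ r) (sub-anti q r<s))
  }
  where open ℝ x

-- c ≤ y / n ^ℚ r says c ≤ y / nʳ for n ≥ 1.  With d the denominator of r,
-- it is c nʳ ≤ y raised to the power d; a negative exponent of n is moved to
-- the other side.

infix 4 _≤_/_^ℚ_ _≤_/_^ℝ_

_≤_/_^ℚ_ : ℕ → ℕ → ℕ → ℚ → Set
c ≤ y / n ^ℚ r with ↥ r
... | + k      = c ^ ↧ₙ r * n ^ k ≤ y ^ ↧ₙ r
... | -[1+ k ] = c ^ ↧ₙ r ≤ y ^ ↧ₙ r * n ^ suc k

-- c ≤ y / n ^ℝ x says c ≤ y / nˣ for n ≥ 1: there nˣ is the supremum of nʳ
-- over the rationals r < x.

_≤_/_^ℝ_ : ℕ → ℕ → ℕ → ℝ → Set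
c ≤ y / n ^ℝ x = ∀ r → ℝ.lower x r → c ≤ y / n ^ℚ r

IsPrimePower : ℕ → Set
IsPrimePower q = ∃₂ λ p k → Prime p × q ≡ p ^ suc k

module Submission where

-- A Carmichael polynomial f of degree n satisfies x ^ (q ^ n) ≡ x modulo f for all x,
-- so it is squarefree and its irreducible factors have degrees dividing n.  Hence n is
-- the sum of the degrees of the irreducible factors of f, and summing over f gives
-- n C ≤ ∑ d N(d) q^(n-d) over the divisors d of n, where N(d) is the number of monic
-- irreducibles of degree d.  They all divide X ^ (q ^ d) - X, so d N(d) ≤ q^d and
-- n C ≤ τ(n) q^n ≤ 2 √n q^n; finally n^ε absorbs the constant 2.

open import Defs
open import Data.Nat.Base using (ℕ; _^_; _<_)
open import Data.Nat.Primality using (Composite)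
open import Data.Rational.Base using (0ℚ; ½)
open import Data.Product.Base using (∃-syntax)

open import Level using (Level; _⊔_)
open import Algebra.Bundles using (Ring; CommutativeRing)
open import Data.Nat.Base as ℕ using (zero; suc; _+_; _*_; _≤_; _>_; z≤n; s≤s; NonZero)
import Data.Nat.Properties as ℕₚ
import Data.Nat.Divisibility as ℕᵈ
open import Data.Nat.DivMod using (_%_; _/_; m≡m%n+[m/n]*n; m%n<n; m/n≤m; m*n/n≡m; /-congˡ)
open import Data.Nat.Induction using (<-rec)
open import Data.Nat.Tactic.RingSolver using (solve-∀)
open import Data.Integer.Base as ℤ using (-[1+_]; +[1+_])
import Data.Integer.Properties as ℤₚ
open import Data.Rational.Base as ℚ using (↥_; ↧ₙ_)
import Data.Rational.Properties as ℚₚ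
import Data.Rational.Unnormalised.Properties as ℚᵘₚ
open import Data.Fin.Base using (Fin; zero; suc; toℕ; fromℕ<; splitAt; _↑ˡ_; _↑ʳ_; punchOut)
import Data.Fin.Properties as Finₚ
import Data.Fin.Permutation as Perm
open import Data.List.Base using ([]; _∷_)
open import Data.Vec.Functional using (Vector; replicate; removeAt; _++_)
open import Data.Product.Base using (Σ; ∃; ∃₂; _×_; _,_; proj₁; proj₂)
open import Data.Sum.Base using (_⊎_; inj₁; inj₂; [_,_])
open import Function.Base using (_∘_)
open import Function.Bundles using (Inverse; Equivalence)
open import Relation.Nullary using (¬_; Dec; yes; no; contradiction)
open import Relation.Nullary.Decidable using (¬?; _×-dec_)
open import Relation.Binary.Definitions using (tri<; tri≈; tri>)
open import Relation.Binary.PropositionalEquality as ≡ using (_≡_)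
import Relation.Binary.Reasoning.Setoid as SetoidReasoning
import Algebra.Properties.Ring as RingProperties
import Algebra.Properties.CommutativeMonoid.Sum as Sum
import Algebra.Properties.Semiring.Exp as Exp
import Algebra.Properties.Semiring.Sum as SemiringSum
import Algebra.Properties.Semiring.Divisibility as Divisibility
open SemiringSum ℕₚ.+-*-semiring using (sum; ∑-comm; *-distribˡ-sum; sum-syntax)

-- Both facts needed about an irreducible `p` of degree `d`, Euclid's lemma and `p` dividing
-- `X ^ (q ^ d) - X`, come from its residue field, which is therefore built as a `FiniteField` with
-- `q ^ d` elements in its own right. Unique factorization is avoided: peeling off one irreducible
-- factor at a time shows that `n` is at most the sum of the degrees of the irreducible divisors,
-- and this inequality suffices. Roots and real powers never occur: the estimate is kept in the
-- squared form `C² n ≤ 4 Q²`, and a rational `s` between 0 and `ε` turns every comparison of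
-- exponents into one between natural numbers.

private
  variable
    a ℓ : Level
    q : ℕ

-- Multiplication in a finite field and Fermat's theorem.

module FiniteFieldProperties (F : FiniteField a ℓ q) where
  open FiniteField F using (isField; finite; commutativeRing)
  open IsField isField using (1≉0) renaming (inverse to invert)
  open CommutativeRing commutativeRing hiding (zero)
    renaming (_*_ to _·_; _+_ to _⊕_)
  open Finite finite using (_≟_)
  open Exp semiring using () renaming (_^_ to _^ᴿ_)
  open Sum *-commutativeMonoid using (sum-remove; sum-permute; sum-cong-≋; sum-replicate)
    renaming (sum to product; ∑-distrib-+ to ∏-distrib-*)
  open SetoidReasoning setoid
  private module I = Inverse finite

  *-cancelʳ-≉0 : ∀ x {y z} → ¬ x ≈ 0# → y · x ≈ z · x → y ≈ z
  *-cancelʳ-≉0 x {y} {z} x≉0 e with x⁻¹ , xx⁻¹≈1 ← invert x x≉0 = begin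
    y                ≈⟨ *-identityʳ y ⟨
    y · 1#           ≈⟨ *-congˡ xx⁻¹≈1 ⟨
    y · (x · x⁻¹)    ≈⟨ *-assoc y x x⁻¹ ⟨
    (y · x) · x⁻¹    ≈⟨ *-congʳ e ⟩
    (z · x) · x⁻¹    ≈⟨ *-assoc z x x⁻¹ ⟩
    z · (x · x⁻¹)    ≈⟨ *-congˡ xx⁻¹≈1 ⟩
    z · 1#           ≈⟨ *-identityʳ z ⟩
    z                ∎

  *-≉0 : ∀ {x y} → ¬ x ≈ 0# → ¬ y ≈ 0# → ¬ x · y ≈ 0#
  *-≉0 {x} {y} x≉0 y≉0 e = x≉0 (*-cancelʳ-≉0 y y≉0 (trans e (sym (zeroˡ y))))

  product-≉0 : ∀ {n} (t : Vector Carrier n) → (∀ i → ¬ t i ≈ 0#) → ¬ product t ≈ 0#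
  product-≉0 {zero}  t h = 1≉0
  product-≉0 {suc n} t h = *-≉0 (h zero) (product-≉0 (t ∘ suc) (h ∘ suc))

  q>1 : 1 < q
  q>1 = Finₚ.injective⇒≤ {f = λ { zero → I.from 0# ; (suc _) → I.from 1# }}
    λ { {zero} {zero} _ → ≡.refl
      ; {zero} {suc zero} e → contradiction (sym (from-injective e)) 1≉0
      ; {suc zero} {zero} e → contradiction (from-injective e) 1≉0
      ; {suc zero} {suc zero} _ → ≡.refl }
    where
    from-injective : ∀ {x y} → I.from x ≡ I.from y → x ≈ y
    from-injective e = trans (sym (I.inverseˡ ≡.refl)) (I.inverseˡ e)

  private
    ifZero : Carrier → Carrier → Carrier
    ifZero x y with x ≟ 0#
    ... | yes _ = 1#
    ... | no _  = y

    ifZero-yes : ∀ {x} y → x ≈ 0# → ifZero x y ≈ 1#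
    ifZero-yes {x} y x≈0 with x ≟ 0#
    ... | yes _  = refl
    ... | no x≉0 = contradiction x≈0 x≉0

    ifZero-no : ∀ {x} y → ¬ x ≈ 0# → ifZero x y ≈ y
    ifZero-no {x} y x≉0 with x ≟ 0#
    ... | yes x≈0 = contradiction x≈0 x≉0
    ... | no _    = refl

    ifZero-≉0 : ∀ x → ¬ ifZero x x ≈ 0#
    ifZero-≉0 x with x ≟ 0#
    ... | yes _  = 1≉0
    ... | no x≉0 = x≉0

  -- Multiplication by x permutes the field, so replacing 0 by 1 in the product
  -- of all elements and comparing both sides leaves x to the power q ∸ 1.
  fermat : ∀ x → x ^ᴿ q ≈ x
  fermat x = ^-cardinality q finite x
    where
    -- The order is generalized to a variable so that it can be split as `suc m`; the nonzero
    -- elements then number `m`.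
    ^-cardinality : ∀ n → HasCardinality n setoid → ∀ x → x ^ᴿ n ≈ x
    ^-cardinality zero    fin x with () ← Inverse.from fin x
    ^-cardinality (suc m) fin x with x ≟ 0#
    ... | yes x≈0 = trans (*-congʳ x≈0) (trans (zeroˡ _) (sym x≈0))
    ... | no x≉0 = trans (*-congˡ x^m≈1) (*-identityʳ x)
      where
      module J = Inverse fin
      to-from : ∀ y → J.to (J.from y) ≈ y
      to-from y = J.inverseˡ ≡.refl
      x⁻¹ = proj₁ (invert x x≉0)
      xx⁻¹≈1 = proj₂ (invert x x≉0)

      scale : Carrier → Fin (suc m) → Fin (suc m)
      scale y i = J.from (y · J.to i)
      scale-inverse : ∀ y z → y · z ≈ 1# → ∀ i → scale y (scale z i) ≡ i
      scale-inverse y z yz≈1 i = J.inverseʳ (begin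
        y · J.to (J.from (z · J.to i))   ≈⟨ *-congˡ (to-from _) ⟩
        y · (z · J.to i)                 ≈⟨ *-assoc y z _ ⟨
        (y · z) · J.to i                 ≈⟨ *-congʳ yz≈1 ⟩
        1# · J.to i                      ≈⟨ *-identityˡ _ ⟩
        J.to i                           ∎)
      π : Perm.Permutation (suc m) (suc m)
      π = Perm.permutation (scale x) (scale x⁻¹) (scale-inverse x x⁻¹ xx⁻¹≈1)
            (scale-inverse x⁻¹ x (trans (*-comm x⁻¹ x) xx⁻¹≈1))

      elements factors : Vector Carrier (suc m)
      elements i = ifZero (J.to i) (J.to i)
      factors i = ifZero (J.to i) x

      permuted : ∀ i → elements (scale x i) ≈ factors i · elements i
      permuted i = cases (J.to i ≟ 0#)
        where
        y = J.to i
        xy = J.to (scale x i)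
        cases : Dec (y ≈ 0#) → ifZero xy xy ≈ ifZero y x · ifZero y y
        cases (yes y≈0) = begin
          ifZero xy xy               ≈⟨ ifZero-yes xy (trans (to-from _) (trans (*-congˡ y≈0) (zeroʳ x))) ⟩
          1#                         ≈⟨ *-identityˡ 1# ⟨
          1# · 1#                    ≈⟨ *-cong (ifZero-yes x y≈0) (ifZero-yes y y≈0) ⟨
          ifZero y x · ifZero y y    ∎
        cases (no y≉0) = begin
          ifZero xy xy               ≈⟨ ifZero-no xy (λ e → *-≉0 x≉0 y≉0 (trans (sym (to-from _)) e)) ⟩
          xy                         ≈⟨ to-from (x · y) ⟩
          x · y                      ≈⟨ *-cong (ifZero-no x y≉0) (ifZero-no y y≉0) ⟨
          ifZero y x · ifZero y y    ∎

      product-factors : product factors ≈ 1#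
      product-factors = *-cancelʳ-≉0 (product elements)
        (product-≉0 elements (λ i → ifZero-≉0 (J.to i))) (begin
          product factors · product elements          ≈⟨ ∏-distrib-* factors elements ⟨
          product (λ i → factors i · elements i)      ≈⟨ sum-cong-≋ permuted ⟨
          product (λ i → elements (scale x i))        ≈⟨ sum-permute elements π ⟨
          product elements                            ≈⟨ *-identityˡ _ ⟨
          1# · product elements                       ∎)

      i₀ = J.from 0#
      x^m≈1 : x ^ᴿ m ≈ 1#
      -- The index of 0 carries the factor 1, and each of the remaining `m` indices carries `x`.
      x^m≈1 = begin
        x ^ᴿ m                                     ≈⟨ sum-replicate m ⟨
        product (replicate m x)                   ≈⟨ sum-cong-≋ (λ j → ifZero-no x
          (λ e → Finₚ.punchInᵢ≢i i₀ j (≡.sym (J.inverseʳ (sym e))))) ⟨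
        product (removeAt factors i₀)                ≈⟨ *-identityˡ _ ⟨
        1# · product (removeAt factors i₀)           ≈⟨ *-congʳ (ifZero-yes x (to-from 0#)) ⟨
        factors i₀ · product (removeAt factors i₀)   ≈⟨ sum-remove factors ⟨
        product factors                              ≈⟨ product-factors ⟩
        1#                                           ∎

-- Polynomials over a finite field: degrees, divisibility, irreducibility.

module FiniteFieldPolynomials (F : FiniteField a ℓ q) where
  open FiniteField F using (isField; finite; commutativeRing)
  open IsField isField using (1≉0) renaming (inverse to invert)
  open CommutativeRing commutativeRing
    using (_≈_; 0#; 1#; -_; ring; semiring; setoid; refl; reflexive; sym; trans; zeroˡ; zeroʳ;
           +-identityˡ; +-identityʳ; +-cong; +-congʳ; -‿cong;
           *-comm; *-cong; *-congˡ; *-congʳ; *-identityˡ; *-identityʳ)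
    renaming (Carrier to A; _*_ to _·_; _+_ to _⊕_)
  open Finite finite using (_≟_)
  open FiniteFieldProperties F using (*-≉0; q>1)
  open Polynomial commutativeRing
  open Count finite
  open CommutativeRing polynomialRing using () renaming (semiring to polynomialSemiring)
  open Divisibility polynomialSemiring
    using (_∣_; ∣ʳ-respˡ-≈; ∣ʳ-respʳ-≈; ∣ʳ-trans; ∣ʳ-refl) renaming (_,_ to divides)
  private
    module K = SetoidReasoning setoid
    module P = SetoidReasoning polySetoid

  -- `c` may be zero, so that `leading-*` needs no cancellation; `¬ c ≈ 0#` is assumed separately
  -- where degrees are compared. `IsMonic` is the case `c = 1#`.
  Leading : A → ℕ → Poly → Set ℓ
  Leading c n p = coeff p n ≈ c × (∀ i → i > n → coeff p i ≈ 0#)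

  leading-resp : ∀ {c n p r} → p ≋ r → Leading c n p → Leading c n r
  leading-resp e (lead , above) =
    trans (sym (coeff-≈ e _)) lead , λ i i>n → trans (sym (coeff-≈ e i)) (above i i>n)

  degree? : ∀ p → p ≋ [] ⊎ ∃₂ λ c n → ¬ c ≈ 0# × Leading c n p
  degree? [] = inj₁ ≋-refl
  degree? (x ∷ p) with degree? p
  ... | inj₂ (c , n , c≉0 , lead , above) =
        inj₂ (c , suc n , c≉0 , lead , λ { (suc i) (s≤s i>n) → above i i>n })
  ... | inj₁ p≋[] with x ≟ 0#
  ...   | yes x≈0 = inj₁ (≋-trans (∷-cong x≈0 p≋[]) 0∷[])
  ...   | no x≉0  = inj₂ (x , 0 , x≉0 , refl , λ { (suc i) _ → coeff-≈ p≋[] i })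

  leading-≉[] : ∀ {c n} p → ¬ c ≈ 0# → Leading c n p → ¬ p ≋ []
  leading-≉[] p c≉0 (lead , _) p≋[] = c≉0 (trans (sym lead) (coeff-≈ p≋[] _))

  leading-low : ∀ {c m n} p → ¬ c ≈ 0# → Leading c m p → LowDegree n p → m < n
  leading-low p c≉0 (lead , _) low = ℕₚ.≰⇒> λ n≤m → c≉0 (trans (sym lead) (low _ n≤m))

  leading-degree : ∀ {c d m n} p → ¬ c ≈ 0# → ¬ d ≈ 0# → Leading c m p → Leading d n p → m ≡ n
  leading-degree p c≉0 d≉0 hc hd = ℕₚ.≤-antisym
    (ℕₚ.≤-pred (leading-low p c≉0 hc (proj₂ hd))) (ℕₚ.≤-pred (leading-low p d≉0 hd (proj₂ hc)))

  -- Peel off the constant term `x` of the left factor: `x ∙ₚ r` does not reach the coefficients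
  -- above `n`, so there multiplying by `x ∷ p` only shifts `p *ₚ r`.
  leading-* : ∀ {c d m n} p r → Leading c m p → Leading d n r → Leading (c · d) (m + n) (p *ₚ r)
  leading-* {c} {d} [] r (lead , _) _ =
    trans (sym (zeroˡ d)) (*-congʳ lead) , λ i _ → refl
  leading-* {c} {d} {zero} {n} (x ∷ p) r (lead , above) (lead′ , above′) =
    leading-resp (≋-sym x∷p*r) (trans (coeff-∙ x r n) (*-cong lead lead′)
                               , λ i i>n → trans (coeff-∙ x r i) (trans (*-congˡ (above′ i i>n)) (zeroʳ x)))
    where
    p≋[] : p ≋ []
    p≋[] = ≋-intro λ i → above (suc i) (s≤s z≤n)
    x∷p*r : (x ∷ p) *ₚ r ≋ x ∙ₚ r
    x∷p*r = ≋-trans (+ₚ-cong (≋-refl {x ∙ₚ r}) (≋-trans (∷-cong refl (*ₚ-cong p≋[] (≋-refl {r}))) 0∷[]))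
                    (+ₚ-identityʳ (x ∙ₚ r))
  leading-* {c} {d} {suc m} {n} (x ∷ p) r (lead , above) hr@(_ , above′) =
    trans (product-coeff (m + n) (ℕₚ.m≤n+m n m)) (proj₁ IH)
    , λ { (suc i) (s≤s i>m+n) →
            trans (product-coeff i (ℕₚ.≤-trans (ℕₚ.m≤n+m n m) (ℕₚ.<⇒≤ i>m+n))) (proj₂ IH i i>m+n) }
    where
    IH = leading-* {c} {d} {m} {n} p r (lead , λ i i>m → above (suc i) (s≤s i>m)) hr
    product-coeff : ∀ i → n ≤ i → coeff ((x ∷ p) *ₚ r) (suc i) ≈ coeff (p *ₚ r) i
    product-coeff i n≤i = K.begin
      coeff ((x ∷ p) *ₚ r) (suc i)                K.≈⟨ coeff-+ (x ∙ₚ r) (0# ∷ p *ₚ r) (suc i) ⟩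
      coeff (x ∙ₚ r) (suc i) ⊕ coeff (p *ₚ r) i   K.≈⟨ +-congʳ (coeff-∙ x r (suc i)) ⟩
      x · coeff r (suc i) ⊕ coeff (p *ₚ r) i
        K.≈⟨ +-congʳ (trans (*-congˡ (above′ (suc i) (s≤s n≤i))) (zeroʳ x)) ⟩
      0# ⊕ coeff (p *ₚ r) i                       K.≈⟨ +-identityˡ _ ⟩
      coeff (p *ₚ r) i                            K.∎

  monic-* : ∀ {m n} p r → IsMonic m p → IsMonic n r → IsMonic (m + n) (p *ₚ r)
  monic-* p r hp hr with lead , above ← leading-* p r hp hr = trans lead (*-identityˡ 1#) , above

  monic-quotient : ∀ {m n} h p → IsMonic m p → IsMonic n (h *ₚ p) → ∃[ k ] IsMonic k h × k + m ≡ n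
  monic-quotient {m} {n} h p hp hhp with degree? h
  ... | inj₁ h≋[] = contradiction (*ₚ-cong h≋[] (≋-refl {p})) (leading-≉[] (h *ₚ p) 1≉0 hhp)
  ... | inj₂ (c , k , c≉0 , lead , above) = k , (trans lead c≈1 , above) , k+m≡n
    where
    h*p : Leading (c · 1#) (k + m) (h *ₚ p)
    h*p = leading-* h p (lead , above) hp
    k+m≡n : k + m ≡ n
    k+m≡n = leading-degree (h *ₚ p) (*-≉0 c≉0 1≉0) 1≉0 h*p hhp
    c≈1 : c ≈ 1#
    c≈1 = trans (sym (*-identityʳ c)) (trans (sym (proj₁ h*p))
      (trans (reflexive (≡.cong (coeff (h *ₚ p)) k+m≡n)) (proj₁ hhp)))

  monic-∣ : ∀ {m n} p r → IsMonic m p → IsMonic n r → p ∣ r →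
            ∃₂ λ k h → IsMonic k h × k + m ≡ n × h *ₚ p ≋ r
  monic-∣ p r hp hr (divides h e)
    with k , hh , k+m≡n ← monic-quotient h p hp (leading-resp (≋-sym e) hr) = k , h , hh , k+m≡n , e

  monic-zero : ∀ p → IsMonic 0 p → p ≋ 1ₚ
  monic-zero p (lead , above) = ≋-intro λ { zero → lead ; (suc i) → above (suc i) (s≤s z≤n) }

  -- The cofactor is monic of degree 0, hence 1.
  monic-∣-≡ : ∀ {n} p r → IsMonic n p → IsMonic n r → p ∣ r → p ≋ r
  monic-∣-≡ {n} p r hp hr p∣r with k , h , hh , k+n≡n , e ← monic-∣ p r hp hr p∣r
    with ≡.refl ← ℕₚ.+-cancelʳ-≡ n k 0 k+n≡n =
    ≋-trans (≋-sym (≋-trans (*ₚ-cong (monic-zero h hh) (≋-refl {p})) (*ₚ-identityˡ p))) e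

  module _ (f : Poly) where
    open PrincipalQuotient polynomialRing f

    ~[]⇒∣ : ∀ {p} → p ~ [] → f ∣ p
    ~[]⇒∣ {p} (mod d) = ∣ʳ-respʳ-≈ (+ₚ-identityʳ p) d

    ∣⇒~[] : ∀ {p} → f ∣ p → p ~ []
    ∣⇒~[] {p} d = mod (∣ʳ-respʳ-≈ (≋-sym (+ₚ-identityʳ p)) d)

  ∣? : ∀ {n} p → IsMonic n p → ∀ r → Dec (p ∣ r)
  ∣? {n} p hp r = cases (degree? (remainder r))
    where
    open Division {n} {p} hp
    open PrincipalQuotient polynomialRing p
    cases : remainder r ≋ [] ⊎ (∃₂ λ c m → ¬ c ≈ 0# × Leading c m (remainder r)) → Dec (p ∣ r)
    cases (inj₁ e) = yes (~[]⇒∣ p (~-trans (~-sym (remainder-~ r)) (≈⇒~ e)))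
    cases (inj₂ (c , m , c≉0 , lead)) = no λ p∣r → leading-≉[] (remainder r) c≉0 lead
      (low-unique (remainder-low r) (λ _ _ → refl) (~-trans (remainder-~ r) (∣⇒~[] p p∣r)))

  -- Ranging over monic factors of bounded degree makes the search finite, so irreducibility is
  -- decidable and the irreducibles of a given degree can be counted.
  ProperFactor : ℕ → Poly → Set (a ⊔ ℓ)
  ProperFactor n p = ∃ λ m → m < n × 0 < m × ∃ λ (h : Σ Poly (IsMonic m)) → proj₁ h ∣ p

  Irreducible : ℕ → Poly → Set (a ⊔ ℓ)
  Irreducible n p = 0 < n × ¬ ProperFactor n p

  properFactor? : ∀ n p → Dec (ProperFactor n p)
  properFactor? n p = ℕₚ.anyUpTo? (λ m → (0 ℕₚ.<? m) ×-dec
    Finite.any? (monic-cardinality m) {P = λ h → proj₁ h ∣ p} (λ e → ∣ʳ-respˡ-≈ e) (λ (h , hm) → ∣? h hm p)) n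

  irreducible? : ∀ n p → Dec (Irreducible n p)
  irreducible? n p = (0 ℕₚ.<? n) ×-dec ¬? (properFactor? n p)

  irreducible-resp : ∀ {n p r} → p ≋ r → Irreducible n p → Irreducible n r
  irreducible-resp e (n>0 , irr) =
    n>0 , λ (m , m<n , m>0 , h , h∣r) → irr (m , m<n , m>0 , h , ∣ʳ-respʳ-≈ (≋-sym e) h∣r)

  IrreducibleFactor : Poly → Set (a ⊔ ℓ)
  IrreducibleFactor p = ∃₂ λ m r → IsMonic m r × Irreducible m r × r ∣ p

  irreducible-factor : ∀ n → 0 < n → ∀ p → IsMonic n p → IrreducibleFactor p
  irreducible-factor = <-rec _ λ n IH n>0 p hp → cases n IH n>0 p hp (properFactor? n p)
    where
    cases : ∀ n → (∀ {m} → m < n → 0 < m → ∀ p → IsMonic m p → IrreducibleFactor p) →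
            0 < n → ∀ p → IsMonic n p → Dec (ProperFactor n p) → IrreducibleFactor p
    cases n IH n>0 p hp (no irr) = n , p , hp , (n>0 , irr) , ∣ʳ-refl
    cases n IH n>0 p hp (yes (m , m<n , m>0 , (h , hh) , h∣p))
      with k , r , hr , irr , r∣h ← IH m<n m>0 h hh = k , r , hr , irr , ∣ʳ-trans r∣h h∣p

  -- The residue field of an irreducible polynomial.

  module ResidueField {d : ℕ} (p : Poly) (monic : IsMonic d p) (irreducible : Irreducible d p) where
    open PrincipalQuotient polynomialRing p

    private
      InvertibleAt : ℕ → Set (a ⊔ ℓ)
      InvertibleAt n = ∀ {c} r → ¬ c ≈ 0# → Leading c n r → n < d → ∃[ u ] r *ₚ u ~ 1ₚ

    -- The Euclidean algorithm: replace r by the remainder of p modulo r.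
    invert-leading : ∀ n → InvertibleAt n
    invert-leading = <-rec _ step
      where
      step : ∀ n → (∀ {m} → m < n → InvertibleAt m) → InvertibleAt n
      step n IH {c} r c≉0 hr n<d with b , cb≈1 ← invert c c≉0 = cases n IH hs n<d
        where
        -- Division is by monic polynomials, so `r` is first scaled by the inverse `b` of its
        -- leading coefficient.
        s = (b ∷ []) *ₚ r
        hs : IsMonic n s
        hs with lead , above ← leading-* (b ∷ []) r (refl , λ { (suc i) _ → refl }) hr =
          trans lead (trans (*-comm b c) cb≈1) , above
        cases : ∀ n → (∀ {m} → m < n → InvertibleAt m) → IsMonic n s → n < d → ∃[ u ] r *ₚ u ~ 1ₚ
        cases zero    IH hs n<d = b ∷ [] , ≈⇒~ (≋-trans (*ₚ-comm r (b ∷ [])) (monic-zero s hs))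
        cases n@(suc _) IH hs n<d = descend (degree? rem) (remainder-~ p)
          where
          open Division {n} {s} hs hiding (step)
          rem = remainder p
          descend : rem ≋ [] ⊎ (∃₂ λ c m → ¬ c ≈ 0# × Leading c m rem) →
                    PrincipalQuotient._~_ polynomialRing s rem p → ∃[ u ] r *ₚ u ~ 1ₚ
          -- A zero remainder would make `s` a proper factor of `p`, since `0 < n < d`.
          descend (inj₁ rem≋[]) rem~p = contradiction
            (n , n<d , s≤s z≤n , (s , hs) , ~[]⇒∣ s (S.~-trans (S.~-sym rem~p) (S.≈⇒~ rem≋[])))
            (proj₂ irreducible)
            where module S = PrincipalQuotient polynomialRing s
          descend (inj₂ (c′ , m , c′≉0 , lead)) (PrincipalQuotient.mod (divides w e)) = u , r*u~1
            where
            m<n : m < n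
            m<n = leading-low rem c′≉0 lead (remainder-low p)
            inverse : ∃[ v ] rem *ₚ v ~ 1ₚ
            inverse = IH m<n rem c′≉0 lead (ℕₚ.<-trans m<n n<d)
            v = proj₁ inverse
            -- `e` reads `w s = rem - p`, so modulo `p` the remainder is `w s = w b r`, and its
            -- inverse `v` turns into the inverse `w b v` of `r`.
            u = (w *ₚ (b ∷ [])) *ₚ v
            w*s~rem : w *ₚ s ~ rem
            w*s~rem = ~-trans (≈⇒~ e) (~-trans
              (+-cong~ {rem} {rem} (≈⇒~ ≋-refl) (-‿cong~ (∣⇒~[] p ∣ʳ-refl)))
              (≈⇒~ (+ₚ-identityʳ rem)))
            r*u≋w*s*v : r *ₚ u ≋ (w *ₚ s) *ₚ v
            r*u≋w*s*v = P.begin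
              r *ₚ ((w *ₚ (b ∷ [])) *ₚ v)   P.≈⟨ *ₚ-assoc r (w *ₚ (b ∷ [])) v ⟨
              (r *ₚ (w *ₚ (b ∷ []))) *ₚ v   P.≈⟨ *ₚ-cong (*ₚ-comm r (w *ₚ (b ∷ []))) (≋-refl {v}) ⟩
              ((w *ₚ (b ∷ [])) *ₚ r) *ₚ v   P.≈⟨ *ₚ-cong (*ₚ-assoc w (b ∷ []) r) (≋-refl {v}) ⟩
              (w *ₚ s) *ₚ v                 P.∎
            r*u~1 : r *ₚ u ~ 1ₚ
            r*u~1 = ~-trans (≈⇒~ r*u≋w*s*v)
              (~-trans (*-cong~ {u = v} {v} w*s~rem (≈⇒~ ≋-refl)) (proj₂ inverse))

    -- Being a `FiniteField` again, the quotient inherits cancellation, Fermat's theorem and the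
    -- root count `all-fixed⇒q≤`.
    residueField : FiniteField a (a ⊔ ℓ) (q ^ d)
    residueField = record
      { ring = quotientRing
      ; isField = record
        { *-comm = λ x y → ≈⇒~ (*ₚ-comm x y)
        ; 1≉0 = λ 1~0 → leading-≉[] 1ₚ 1≉0 (monomial-monic 0) (low-unique {1ₚ} {[]}
            (λ i i≥d → proj₂ (monomial-monic 0) i (ℕₚ.≤-trans (proj₁ irreducible) i≥d)) (λ _ _ → refl) 1~0)
        ; inverse = inverse
        }
      ; finite = quotient-cardinality monic
      }
      where
      open Division {d} {p} monic
      inverse : ∀ x → ¬ x ~ [] → ∃[ y ] x *ₚ y ~ 1ₚ
      inverse x x≁0 with degree? (remainder x)
      ... | inj₁ e = contradiction (~-trans (~-sym (remainder-~ x)) (≈⇒~ e)) x≁0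
      ... | inj₂ (c , m , c≉0 , lead)
        with u , e ← invert-leading m (remainder x) c≉0 lead
                       (leading-low (remainder x) c≉0 lead (remainder-low x)) =
        u , ~-trans (*-cong~ {u = u} {u} (~-sym (remainder-~ x)) (≈⇒~ ≋-refl)) e

    -- Cancellation of the nonzero class of `x` in the residue field.
    euclid : ∀ x y → p ∣ x *ₚ y → ¬ p ∣ x → p ∣ y
    euclid x y p∣xy p∤x = ~[]⇒∣ p (FiniteFieldProperties.*-cancelʳ-≉0 residueField x
      (p∤x ∘ ~[]⇒∣ p) (~-trans (≈⇒~ (*ₚ-comm y x)) (∣⇒~[] p p∣xy)))

  -- Bounds on the number of irreducibles and of roots.

  open ResidueField using (residueField; euclid)

  -- Dividing `h` by `p zero` lowers the degree by `d`. By `euclid` the other `p i` divide the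
  -- cofactor: none divides `p zero`, since monic polynomials of equal degree dividing one another
  -- coincide.
  irreducibles-∣ : ∀ {d} N (p : Fin N → Poly) →
                   (∀ i → IsMonic d (p i)) → (∀ i → Irreducible d (p i)) → (∀ {i j} → p i ≋ p j → i ≡ j) →
                   ∀ {n} h → IsMonic n h → (∀ i → p i ∣ h) → N * d ≤ n
  irreducibles-∣ zero    p monic irr inj h hh p∣h = z≤n
  irreducibles-∣ {d} (suc N) p monic irr inj h hh p∣h
    with k , g , hg , ≡.refl , e ← monic-∣ (p zero) h (monic zero) hh (p∣h zero) =
    ℕₚ.≤-trans (ℕₚ.≤-reflexive (ℕₚ.+-comm d (N * d))) (ℕₚ.+-monoˡ-≤ d
      (irreducibles-∣ N (p ∘ suc) (monic ∘ suc) (irr ∘ suc) (Finₚ.suc-injective ∘ inj) g hg p∣g))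
    where
    p∣g : ∀ i → p (suc i) ∣ g
    p∣g i = euclid (p (suc i)) (monic (suc i)) (irr (suc i)) (p zero) g
      (∣ʳ-respʳ-≈ (≋-trans (≋-sym e) (*ₚ-comm g (p zero))) (p∣h (suc i)))
      (λ p∣p₀ → Finₚ.0≢1+n (≡.sym (inj (monic-∣-≡ (p (suc i)) (p zero) (monic (suc i)) (monic zero) p∣p₀))))

  open Exp polynomialSemiring using () renaming (_^_ to _^ₚ_)

  X : Poly
  X = 0# ∷ 1# ∷ []

  X-monic : IsMonic 1 X
  X-monic = monomial-monic 1

  X^-monic : ∀ n → IsMonic n (X ^ₚ n)
  X^-monic zero    = monomial-monic 0
  X^-monic (suc n) = monic-* X (X ^ₚ n) X-monic (X^-monic n)

  X^n-X-monic : ∀ {n} → 1 < n → IsMonic n (X ^ₚ n +ₚ -ₚ X)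
  X^n-X-monic {n} n>1 =
    trans (coeff-sub (X ^ₚ n) X n) (trans (+-cong (proj₁ (X^-monic n)) (-X n n>1)) (+-identityʳ 1#)) ,
    λ i i>n → trans (coeff-sub (X ^ₚ n) X i)
      (trans (+-cong (proj₂ (X^-monic n) i i>n) (-X i (ℕₚ.<-trans n>1 i>n))) (+-identityʳ 0#))
    where
    -X : ∀ i → 1 < i → - coeff X i ≈ 0#
    -X i i>1 = trans (-‿cong (proj₂ X-monic i i>1)) (RingProperties.-0#≈0# ring)

  quotient-^ : ∀ f x n → Exp._^_ (Ring.semiring K[t]/⟨ f ⟩) x n ≡ x ^ₚ n
  quotient-^ f x zero    = ≡.refl
  quotient-^ f x (suc n) = ≡.cong (x *ₚ_) (quotient-^ f x n)

  open Exp semiring using () renaming (_^_ to _^ᴿ_)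

  constant-^ : ∀ c n → (c ∷ []) ^ₚ n ≋ c ^ᴿ n ∷ []
  constant-^ c zero    = ≋-refl
  constant-^ c (suc n) = ≋-trans (*ₚ-congˡ (c ∷ []) (constant-^ c n))
    (∷-cong (+-identityʳ _) ≋-refl)

  -- Each X - c divides Xⁿ - X.
  all-fixed⇒q≤ : ∀ {n} → 1 < n → (∀ x → x ^ᴿ n ≈ x) → q ≤ n
  all-fixed⇒q≤ {n} n>1 fixed = ℕₚ.≤-trans (ℕₚ.≤-reflexive (≡.sym (ℕₚ.*-identityʳ q)))
    -- The root count is the case of degree 1: linear polynomials are irreducible because no degree
    -- lies strictly between 0 and 1.
    (irreducibles-∣ q (λ i → X-c (I.to i)) (λ i → refl , λ { (suc (suc i)) _ → refl ; 1 (s≤s ()) })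
      (λ i → s≤s z≤n , λ { (m , m<1 , m>0 , _) → ℕₚ.<⇒≱ m<1 m>0 })
      (λ {i} {j} e → I.to-injective (X-c-injective (coeff-≈ e 0)))
      (X ^ₚ n +ₚ -ₚ X) (X^n-X-monic n>1) (λ i → X-c∣ (I.to i)))
    where
    module I where
      open Inverse finite public
      to-injective : ∀ {i j} → to i ≈ to j → i ≡ j
      to-injective e = ≡.trans (≡.sym (inverseʳ refl)) (inverseʳ e)
    X-c : A → Poly
    X-c c = X +ₚ -ₚ (c ∷ [])
    X-c-injective : ∀ {x y} → 0# ⊕ - x ≈ 0# ⊕ - y → x ≈ y
    X-c-injective e = RingProperties.-‿injective ring (trans (sym (+-identityˡ _)) (trans e (+-identityˡ _)))
    X-c∣ : ∀ c → X-c c ∣ X ^ₚ n +ₚ -ₚ X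
    X-c∣ c = _~_.f∣x-y (~-trans X^n~c (~-sym X~c))
      where
      open PrincipalQuotient polynomialRing (X-c c)
      X~c : X ~ c ∷ []
      X~c = mod ∣ʳ-refl
      X^~ : ∀ k → X ^ₚ k ~ (c ∷ []) ^ₚ k
      X^~ zero    = ≈⇒~ ≋-refl
      X^~ (suc k) = *-cong~ {X} {c ∷ []} X~c (X^~ k)
      X^n~c : X ^ₚ n ~ c ∷ []
      X^n~c = ~-trans (X^~ n) (≈⇒~ (≋-trans (constant-^ c n) (∷-cong (fixed c) ≋-refl)))

  -- Fermat's theorem in the residue field, applied to the class of `X`.
  irreducible-∣X^q^d-X : ∀ {d} p → IsMonic d p → Irreducible d p → p ∣ X ^ₚ (q ^ d) +ₚ -ₚ X
  irreducible-∣X^q^d-X {d} p monic irr = _~_.f∣x-y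
    (≡.subst (_~ X) (quotient-^ p X (q ^ d)) (FiniteFieldProperties.fermat (residueField p monic irr) X))
    where open PrincipalQuotient polynomialRing p

  irreducible-count : ∀ {d} N (p : Fin N → Poly) →
                      (∀ i → IsMonic d (p i)) → (∀ i → Irreducible d (p i)) → (∀ {i j} → p i ≋ p j → i ≡ j) → N * d ≤ q ^ d
  irreducible-count {zero}  N p _ _ _ = ℕₚ.≤-trans (ℕₚ.≤-reflexive (ℕₚ.*-zeroʳ N)) z≤n
  irreducible-count {suc d} N p monic irr inj = irreducibles-∣ N p monic irr inj
    (X ^ₚ (q ^ suc d) +ₚ -ₚ X) (X^n-X-monic (ℕₚ.^-monoʳ-< q q>1 {0} {suc d} (s≤s z≤n)))
    (λ i → irreducible-∣X^q^d-X (p i) (monic i) (irr i))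

-- Iterated powers and divisibility of degrees.

-- Iterating x ↦ x ^ p, the exponents k for which every x is fixed by k steps
-- are closed under remainders.
fixed-∣ : ∀ {p d n} .{{_ : NonZero d}} (F : FiniteField a ℓ (p ^ d)) → 1 < p →
          (let open Ring (FiniteField.ring F) using (_≈_; semiring)
               open Exp semiring using () renaming (_^_ to _^ᴿ_)) →
          (∀ x → x ^ᴿ (p ^ n) ≈ x) → d ℕᵈ.∣ n
fixed-∣ {p = p} {d} {n} F p>1 fixed = ℕᵈ.m%n≡0⇒n∣m n d (divisible (n % d) (m%n<n n d) fixed-remainder)
  where
  open Ring (FiniteField.ring F) using (_≈_; semiring; trans; sym)
  open Exp semiring using (^-congʳ; ^-congˡ; ^-assocʳ) renaming (_^_ to _^ᴿ_)
  Fixed : ℕ → Set _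
  Fixed k = ∀ x → x ^ᴿ (p ^ k) ≈ x

  compose : ∀ {j k} → Fixed k → ∀ x → x ^ᴿ (p ^ (j + k)) ≈ x ^ᴿ (p ^ j)
  compose {j} {k} fix x = trans (^-congʳ x (≡.trans (ℕₚ.^-distribˡ-+-* p j k) (ℕₚ.*-comm (p ^ j) (p ^ k))))
    (trans (sym (^-assocʳ x (p ^ k) (p ^ j))) (^-congˡ (p ^ j) (fix x)))

  multiples : ∀ i → Fixed (i * d)
  multiples zero    x = Ring.*-identityʳ (FiniteField.ring F) x
  multiples (suc i) x = trans (compose {d} {i * d} (multiples i) x) (FiniteFieldProperties.fermat F x)

  fixed-remainder : Fixed (n % d)
  fixed-remainder x = trans (sym (compose {n % d} {(n / d) * d} (multiples (n / d)) x))
    (trans (^-congʳ x (≡.cong (p ^_) (≡.sym (m≡m%n+[m/n]*n n d)))) (fixed x))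

  divisible : ∀ r → r < d → Fixed r → r ≡ 0
  divisible zero    _   _   = ≡.refl
  -- A positive remainder below `d` would make all `p ^ d` elements roots of a polynomial of the
  -- smaller degree `p ^ suc r`.
  divisible (suc r) r<d fix = contradiction
    (FiniteFieldPolynomials.all-fixed⇒q≤ F (ℕₚ.^-monoʳ-< p p>1 {0} {suc r} (s≤s z≤n)) fix)
    (ℕₚ.<⇒≱ (ℕₚ.^-monoʳ-< p p>1 r<d))

-- Estimates for finite sums and counts.

sum-mono : ∀ {n} {f g : Fin n → ℕ} → (∀ i → f i ≤ g i) → sum f ≤ sum g
sum-mono {zero}  h = z≤n
sum-mono {suc n} h = ℕₚ.+-mono-≤ (h zero) (sum-mono (h ∘ suc))

-- A gain in a single term survives summation. It serves twice: to count one more irreducible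
-- divisor, and then to gain its degree.
sum-mono-gap : ∀ {n c} {f g : Fin n → ℕ} → (∀ i → f i ≤ g i) → ∀ i → f i + c ≤ g i → sum f + c ≤ sum g
sum-mono-gap {suc n} {c} {f} {g} h zero gap = begin
  (f zero + sum (f ∘ suc)) + c   ≡⟨ ℕₚ.+-assoc (f zero) _ c ⟩
  f zero + (sum (f ∘ suc) + c)   ≡⟨ ≡.cong (f zero +_) (ℕₚ.+-comm _ c) ⟩
  f zero + (c + sum (f ∘ suc))   ≡⟨ ℕₚ.+-assoc (f zero) c _ ⟨
  (f zero + c) + sum (f ∘ suc)   ≤⟨ ℕₚ.+-mono-≤ gap (sum-mono (h ∘ suc)) ⟩
  g zero + sum (g ∘ suc)         ∎
  where open ℕₚ.≤-Reasoning
sum-mono-gap {suc n} {c} {f} {g} h (suc i) gap = begin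
  (f zero + sum (f ∘ suc)) + c   ≡⟨ ℕₚ.+-assoc (f zero) _ c ⟩
  f zero + (sum (f ∘ suc) + c)   ≤⟨ ℕₚ.+-mono-≤ (h zero) (sum-mono-gap (h ∘ suc) i gap) ⟩
  g zero + sum (g ∘ suc)         ∎
  where open ℕₚ.≤-Reasoning

sum-lower : ∀ n {c} {f : Fin n → ℕ} → (∀ i → c ≤ f i) → n * c ≤ sum f
sum-lower zero    h = z≤n
sum-lower (suc n) h = ℕₚ.+-mono-≤ (h zero) (sum-lower n (h ∘ suc))

sum-upper : ∀ n {c} {f : Fin n → ℕ} → (∀ i → f i ≤ c) → sum f ≤ n * c
sum-upper zero    h = z≤n
sum-upper (suc n) h = ℕₚ.+-mono-≤ (h zero) (sum-upper n (h ∘ suc))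

module _ {p} {P : Set p} where
  χ : Dec P → ℕ
  χ (yes _) = 1
  χ (no _)  = 0

  χ-yes : ∀ d → P → χ d ≡ 1
  χ-yes (yes _) p = ≡.refl
  χ-yes (no ¬p) p = contradiction p ¬p

  χ-no : ∀ d → ¬ P → χ d ≡ 0
  χ-no (yes p) ¬p = contradiction p ¬p
  χ-no (no _)  ¬p = ≡.refl

χ-mono : ∀ {p r} {P : Set p} {R : Set r} → (P → R) → ∀ d e → χ {P = P} d ≤ χ {P = R} e
χ-mono f (yes p) (yes r) = s≤s z≤n
χ-mono f (yes p) (no ¬r) = contradiction (f p) ¬r
χ-mono f (no _)  _       = z≤n

-- The pigeonhole principle for a map defined only on `P`: the image of the first counted index is
-- punched out of `Fin m`, leaving a smaller target for the others. Injectivity ranges over all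
-- proofs because `f` may depend on them.
count-≤ : ∀ {p m n} {P : Fin n → Set p} (P? : ∀ i → Dec (P i)) (f : ∀ i → P i → Fin m) →
          (∀ {i j} x y → f i x ≡ f j y → i ≡ j) → ∑[ i < n ] χ (P? i) ≤ m
count-≤ {n = zero} P? f inj = z≤n
count-≤ {m = m} {suc n} P? f inj with P? zero
... | no _ = count-≤ (P? ∘ suc) (λ i → f (suc i)) (λ x y e → Finₚ.suc-injective (inj x y e))
count-≤ {m = zero} {suc n} P? f inj | yes x with () ← f zero x
count-≤ {m = suc m} {suc n} P? f inj | yes x₀ = s≤s (count-≤ (P? ∘ suc) (λ i x → punchOut (apart i x))
  (λ {i} {j} x y e → Finₚ.suc-injective (inj x y (Finₚ.punchOut-injective (apart i x) (apart j y) e))))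
  where
  apart : ∀ i x → ¬ f zero x₀ ≡ f (suc i) x
  apart i x e = Finₚ.0≢1+n (inj x₀ x e)

-- Factors of Carmichael polynomials and the double count.

module CarmichaelPolynomials (F : FiniteField a ℓ q) where
  open FiniteField F using (finite; commutativeRing)
  open FiniteFieldProperties F using (q>1)
  open FiniteFieldPolynomials F
  open Polynomial commutativeRing
  open Count finite
  open CommutativeRing polynomialRing using () renaming (semiring to polynomialSemiring)
  open Divisibility polynomialSemiring
    using (_∣_; ∣ʳ-respˡ-≈; ∣ʳ-trans) renaming (_,_ to divides)
  open Exp polynomialSemiring using () renaming (_^_ to _^ₚ_)
  private module P = SetoidReasoning polySetoid

  module _ {n : ℕ} {f : Poly} (monic : IsMonic n f) (carmichael : IsCarmichael f) where
    open PrincipalQuotient polynomialRing f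
    open IsCarmichaelRing carmichael using () renaming (finite to finite′; fermat to fermat′)

    -- A Carmichael ring carries its own `order`; uniqueness of cardinality identifies it with
    -- `q ^ n`, the number of remainders modulo `f`.
    carmichael-fermat : ∀ x → x ^ₚ (q ^ n) ~ x
    carmichael-fermat x = ≡.subst (_~ x)
      (≡.trans (≡.cong (Exp._^_ (Ring.semiring K[t]/⟨ f ⟩) x)
                 (cardinality-unique {S = Ring.setoid K[t]/⟨ f ⟩} finite′ (quotient-cardinality monic)))
               (quotient-^ f x (q ^ n)))
      (fermat′ x)

    -- The identity of `carmichael-fermat` descends along `p ∣ f` to the residue field of `p`, to
    -- which `fixed-∣` applies.
    carmichael-degree : ∀ {d p} → IsMonic d p → Irreducible d p → p ∣ f → d ℕᵈ.∣ n
    carmichael-degree {d} {p} hp irr p∣f = fixed-∣ {p = q} {d} {n} {{ℕ.>-nonZero (proj₁ irr)}}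
      (ResidueField.residueField p hp irr) q>1
      (λ x → ≡.subst (λ y → PrincipalQuotient._~_ polynomialRing p y x) (≡.sym (quotient-^ p x (q ^ n)))
        (PrincipalQuotient.mod (∣ʳ-trans p∣f (_~_.f∣x-y (carmichael-fermat x)))))

    -- If f = hp and p ∣ h then f ∣ h², so h is nilpotent modulo f; but h is a
    -- power of itself.
    carmichael-squarefree : ∀ {d p} h → 0 < d → IsMonic d p → h *ₚ p ≋ f → ¬ p ∣ h
    carmichael-squarefree {d} {p} h d>0 hp hp≋f (divides k kp≋h) = f∤h (~[]⇒∣ f h~0)
      where
      h² : h *ₚ h ~ []
      h² = ∣⇒~[] f (divides k (P.begin
        k *ₚ f          P.≈⟨ *ₚ-congˡ k hp≋f ⟨
        k *ₚ (h *ₚ p)   P.≈⟨ *ₚ-congˡ k (*ₚ-comm h p) ⟩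
        k *ₚ (p *ₚ h)   P.≈⟨ *ₚ-assoc k p h ⟨
        (k *ₚ p) *ₚ h   P.≈⟨ *ₚ-cong kp≋h (≋-refl {h}) ⟩
        h *ₚ h          P.∎))
      degrees : ∃[ m ] IsMonic m h × m + d ≡ n
      degrees = monic-quotient h p hp (leading-resp (≋-sym hp≋f) monic)
      n>0 : 0 < n
      n>0 = ≡.subst (0 <_) (proj₂ (proj₂ degrees)) (ℕₚ.≤-trans d>0 (ℕₚ.m≤n+m d _))
      vanish : ∀ m → 1 < m → h ^ₚ m ~ []
      vanish (suc (suc m)) _ = ~-trans (≈⇒~ (≋-sym (*ₚ-assoc h h (h ^ₚ m))))
        (*-cong~ {u = h ^ₚ m} h² (≈⇒~ ≋-refl))
      vanish 1 (s≤s ())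
      h~0 : h ~ []
      -- `n > 0` gives `q ^ n ≥ 2`, so `h ^ₚ (q ^ n)` has the factor `h²`.
      h~0 = ~-trans (~-sym (carmichael-fermat h)) (vanish (q ^ n) (ℕₚ.^-monoʳ-< q q>1 {0} {n} n>0))
      f∤h : ¬ f ∣ h
      -- `h` is monic of degree `n - d < n`, too small for a multiple of `f`.
      f∤h f∣h
        with m , hm , m+d≡n ← degrees
        with k′ , _ , _ , k′+n≡m , _ ← monic-∣ f h monic hm f∣h =
        ℕₚ.<⇒≱ (ℕₚ.≤-trans (ℕₚ.m<m+n m d>0) (ℕₚ.≤-reflexive m+d≡n))
          (ℕₚ.≤-trans (ℕₚ.m≤n+m n k′) (ℕₚ.≤-reflexive k′+n≡m))

  abstract
    -- Only the existence of a counting bijection is used, so its construction by search is kept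
    -- opaque.
    irreducibles : ∀ d → ∃[ N ] HasCardinality N (Subsetoid (Monic d) (Irreducible d ∘ proj₁))
    irreducibles d = Finite.sub-cardinality (monic-cardinality d) {P = Irreducible d ∘ proj₁}
      irreducible-resp (λ (p , _) → irreducible? d p)

  module _ (d : ℕ) where
    private module I = Inverse (proj₂ (irreducibles d))

    irr : Fin (proj₁ (irreducibles d)) → Poly
    irr i = proj₁ (proj₁ (I.to i))

    irr-monic : ∀ i → IsMonic d (irr i)
    irr-monic i = proj₂ (proj₁ (I.to i))

    irr-irreducible : ∀ i → Irreducible d (irr i)
    irr-irreducible i = proj₂ (I.to i)

    irr-injective : ∀ {i j} → irr i ≋ irr j → i ≡ j
    irr-injective {i} {j} e = ≡.trans (≡.sym (I.inverseʳ {i} {I.to i} ≋-refl)) (I.inverseʳ {j} {I.to i} e)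

    irr-surjective : ∀ {p} → IsMonic d p → Irreducible d p → ∃[ i ] irr i ≋ p
    irr-surjective {p} hp irr = I.from ((p , hp) , irr) , I.inverseˡ {(p , hp) , irr} ≡.refl

    irreducibleDivisors : Poly → ℕ
    irreducibleDivisors g = sum (λ i → χ (∣? (irr i) (irr-monic i) g))

    irreducibleDivisors-mono : ∀ {g h} → g ∣ h → irreducibleDivisors g ≤ irreducibleDivisors h
    irreducibleDivisors-mono {g} {h} g∣h = sum-mono λ i →
      χ-mono (λ p∣g → ∣ʳ-trans p∣g g∣h) (∣? (irr i) (irr-monic i) g) (∣? (irr i) (irr-monic i) h)

    irreducibleDivisors-gap : ∀ {g h p} → g ∣ h → IsMonic d p → Irreducible d p → p ∣ h → ¬ p ∣ g →
                              irreducibleDivisors g + 1 ≤ irreducibleDivisors h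
    irreducibleDivisors-gap {g} {h} {p} g∣h hp irr-p p∣h p∤g with i , e ← irr-surjective hp irr-p =
      sum-mono-gap
        (λ i → χ-mono (λ p∣g → ∣ʳ-trans p∣g g∣h) (∣? (irr i) (irr-monic i) g) (∣? (irr i) (irr-monic i) h)) i
        (ℕₚ.≤-reflexive (≡.trans
          (≡.cong (_+ 1) (χ-no (∣? (irr i) (irr-monic i) g) (p∤g ∘ ∣ʳ-respˡ-≈ e)))
          (≡.sym (χ-yes (∣? (irr i) (irr-monic i) h) (∣ʳ-respˡ-≈ (≋-sym e) p∣h)))))

  module _ {K : ℕ} (D : Fin K → ℕ) where

    SquareFree : Poly → Set (a ⊔ ℓ)
    SquareFree g = ∀ {d p} h → IsMonic d p → Irreducible d p → h *ₚ p ≋ g → ¬ p ∣ h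

    FactorDegrees : Poly → Set (a ⊔ ℓ)
    FactorDegrees g = ∀ {d p} → IsMonic d p → Irreducible d p → p ∣ g → ∃[ k ] D k ≡ d

    DegreeBound : ℕ → Set (a ⊔ ℓ)
    DegreeBound m = ∀ g → IsMonic m g → SquareFree g → FactorDegrees g →
                    m ≤ sum (λ k → D k * irreducibleDivisors (D k) g)

    -- Write `g = h p` with `p` irreducible of degree `D k`. Passing from `h` to `g` raises the left
    -- side by `D k`; since `p` does not divide `h`, it is a new divisor, and the `k`-th term on the
    -- right grows by at least as much. Repeated values of `D` do no harm to an inequality.
    degree-≤ : ∀ m → DegreeBound m
    degree-≤ = <-rec _ step
      where
      step : ∀ m → (∀ {k} → k < m → DegreeBound k) → DegreeBound m
      step zero    IH g hg sf deg = z≤n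
      step m@(suc _) IH g hg sf deg
        with d , p , hp , irr-p , p∣g ← irreducible-factor m (s≤s z≤n) g hg
        with m′ , h , hh , m′+d≡m , hp≋g ← monic-∣ p g hp hg p∣g
        with k , ≡.refl ← deg hp irr-p p∣g = begin
        m                                                     ≡⟨ m′+d≡m ⟨
        m′ + D k
          ≤⟨ ℕₚ.+-monoˡ-≤ (D k) (IH m′<m h hh sf′ λ hr irr-r r∣h → deg hr irr-r (∣ʳ-trans r∣h h∣g)) ⟩
        sum (λ k → D k * irreducibleDivisors (D k) h) + D k
          ≤⟨ sum-mono-gap (λ k → ℕₚ.*-monoʳ-≤ (D k) (irreducibleDivisors-mono (D k) h∣g)) k gap ⟩
        sum (λ k → D k * irreducibleDivisors (D k) g)         ∎
        where
        open ℕₚ.≤-Reasoning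
        h∣g : h ∣ g
        h∣g = divides p (≋-trans (*ₚ-comm p h) hp≋g)
        m′<m : m′ < m
        m′<m = ℕₚ.≤-trans (ℕₚ.m<m+n m′ (proj₁ irr-p)) (ℕₚ.≤-reflexive m′+d≡m)
        sf′ : SquareFree h
        -- A factor repeated in `h` is repeated in `g = h p`, with cofactor `u p`.
        sf′ {p = r} u hr irr-r ur≋h r∣u = sf (u *ₚ p) hr irr-r (P.begin
          (u *ₚ p) *ₚ r   P.≈⟨ *ₚ-assoc u p r ⟩
          u *ₚ (p *ₚ r)   P.≈⟨ *ₚ-congˡ u (*ₚ-comm p r) ⟩
          u *ₚ (r *ₚ p)   P.≈⟨ *ₚ-assoc u r p ⟨
          (u *ₚ r) *ₚ p   P.≈⟨ *ₚ-cong ur≋h (≋-refl {p}) ⟩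
          h *ₚ p          P.≈⟨ hp≋g ⟩
          g               P.∎) (∣ʳ-trans r∣u (divides p (*ₚ-comm p u)))
        gap : D k * irreducibleDivisors (D k) h + D k ≤ D k * irreducibleDivisors (D k) g
        gap = begin
          D k * irreducibleDivisors (D k) h + D k
            ≡⟨ ≡.cong (D k * irreducibleDivisors (D k) h +_) (ℕₚ.*-identityʳ (D k)) ⟨
          D k * irreducibleDivisors (D k) h + D k * 1   ≡⟨ ℕₚ.*-distribˡ-+ (D k) _ 1 ⟨
          D k * (irreducibleDivisors (D k) h + 1)
            ≤⟨ ℕₚ.*-monoʳ-≤ (D k) (irreducibleDivisors-gap (D k) h∣g hp irr-p p∣g (sf h hp irr-p hp≋g)) ⟩
          D k * irreducibleDivisors (D k) g             ∎

  -- A multiple of `p` is determined by its cofactor, a monic polynomial of degree `n - d`.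
  multiples-count : ∀ {m n d p} (f : Fin m → Poly) →
                    (∀ i → IsMonic n (f i)) → (∀ {i j} → f i ≋ f j → i ≡ j) →
                    (hp : IsMonic d p) → ∑[ j < m ] χ (∣? p hp (f j)) ≤ q ^ (n ℕ.∸ d)
  multiples-count {m} {n} {d} {p} f monic inj hp = count-≤ (λ j → ∣? p hp (f j))
    (λ j p∣f → M.from (proj₁ (quotient j p∣f)))
    (λ {i} {j} x y e → inj (≋-trans (≋-sym (proj₂ (quotient i x)))
      (≋-trans (*ₚ-cong (M-injective {proj₁ (quotient i x)} {proj₁ (quotient j y)} e) (≋-refl {p}))
        (proj₂ (quotient j y)))))
    where
    module M = Inverse (monic-cardinality (n ℕ.∸ d))
    M-injective : ∀ {x y} → M.from x ≡ M.from y → proj₁ x ≋ proj₁ y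
    M-injective {x} {y} e = ≋-trans (≋-sym (M.inverseˡ {x} ≡.refl)) (M.inverseˡ {y} e)
    quotient : ∀ j → p ∣ f j → Σ (Σ Poly (IsMonic (n ℕ.∸ d))) λ (h , _) → h *ₚ p ≋ f j
    quotient j p∣f with k , h , hh , ≡.refl , e ← monic-∣ p (f j) hp (monic j) p∣f =
      (h , ≡.subst (λ m → IsMonic m h) (≡.sym (ℕₚ.m+n∸n≡m k d)) hh) , e

  -- `D` has only to hit every divisor of `n`: each value, repeated or not a divisor, costs at most
  -- `q ^ n`. The condition `D k ≤ n` makes the truncated `n ∸ d` a true difference, so that `q ^ d`
  -- and `q ^ (n ∸ d)` multiply to `q ^ n`.
  carmichael-bound : ∀ {n m K} (D : Fin K → ℕ) → (∀ k → D k ≤ n) → (∀ d → d ℕᵈ.∣ n → ∃[ k ] D k ≡ d) →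
                     HasCardinality m (Subsetoid (Monic n) (IsCarmichael ∘ proj₁)) → m * n ≤ K * q ^ n
  carmichael-bound {n} {m} {K} D D≤n divisors card = begin
    m * n
      ≤⟨ sum-lower m (λ j → degree-≤ D n (f j) (monic j)
           (λ h hp irr-p → carmichael-squarefree (monic j) (carmichael j) h (proj₁ irr-p) hp)
           (λ {d} hp irr-p p∣f → divisors d (carmichael-degree (monic j) (carmichael j) hp irr-p p∣f))) ⟩
    sum (λ j → sum (λ k → D k * irreducibleDivisors (D k) (f j)))
      ≡⟨ ∑-comm (λ j k → D k * irreducibleDivisors (D k) (f j)) ⟩
    sum (λ k → sum (λ j → D k * irreducibleDivisors (D k) (f j)))
      ≤⟨ sum-upper K (λ k → weight (D k) (D≤n k)) ⟩
    K * q ^ n   ∎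
    where
    open ℕₚ.≤-Reasoning
    module E = Inverse card
    f : Fin m → Poly
    f j = proj₁ (proj₁ (E.to j))
    monic : ∀ j → IsMonic n (f j)
    monic j = proj₂ (proj₁ (E.to j))
    carmichael : ∀ j → IsCarmichael (f j)
    carmichael j = proj₂ (E.to j)
    f-injective : ∀ {i j} → f i ≋ f j → i ≡ j
    f-injective {i} {j} e = ≡.trans (≡.sym (E.inverseʳ {i} {E.to i} ≋-refl)) (E.inverseʳ {j} {E.to i} e)
    weight : ∀ d → d ≤ n → sum (λ j → d * irreducibleDivisors d (f j)) ≤ q ^ n
    weight d d≤n = begin
      sum (λ j → d * irreducibleDivisors d (f j))
        ≡⟨ *-distribˡ-sum d (λ j → irreducibleDivisors d (f j)) ⟨
      d * sum (λ j → irreducibleDivisors d (f j))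
        ≡⟨ ≡.cong (d *_) (∑-comm (λ j i → χ (∣? (irr d i) (irr-monic d i) (f j)))) ⟩
      d * sum (λ i → sum (λ j → χ (∣? (irr d i) (irr-monic d i) (f j))))
        ≤⟨ ℕₚ.*-monoʳ-≤ d (sum-upper N λ i →
             multiples-count {d = d} {irr d i} f monic f-injective (irr-monic d i)) ⟩
      d * (N * q ^ (n ℕ.∸ d))    ≡⟨ ℕₚ.*-assoc d N _ ⟨
      (d * N) * q ^ (n ℕ.∸ d)    ≡⟨ ≡.cong (_* q ^ (n ℕ.∸ d)) (ℕₚ.*-comm d N) ⟩
      (N * d) * q ^ (n ℕ.∸ d)
        ≤⟨ ℕₚ.*-monoˡ-≤ (q ^ (n ℕ.∸ d))
             (irreducible-count N (irr d) (irr-monic d) (irr-irreducible d) (irr-injective d)) ⟩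
      q ^ d * q ^ (n ℕ.∸ d)      ≡⟨ ℕₚ.^-distribˡ-+-* q d (n ℕ.∸ d) ⟨
      q ^ (d + (n ℕ.∸ d))        ≡⟨ ≡.cong (q ^_) (ℕₚ.m+[n∸m]≡n d≤n) ⟩
      q ^ n                      ∎
      where N = proj₁ (irreducibles d)

-- Covering the divisors of `n` by `2 ⌊√n⌋` candidates.

floor-sqrt : ∀ n → ∃[ s ] s * s ≤ n × n < suc s * suc s
floor-sqrt zero = 0 , z≤n , s≤s z≤n
floor-sqrt (suc n) with s , s²≤n , n<s+1² ← floor-sqrt n with suc n ℕₚ.<? suc s * suc s
... | yes n+1<s+1² = s , ℕₚ.m≤n⇒m≤1+n s²≤n , n+1<s+1²
... | no n+1≮s+1² = suc s , ℕₚ.≮⇒≥ n+1≮s+1² ,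
      ℕₚ.<-≤-trans (s≤s n<s+1²) (ℕₚ.*-mono-< (ℕₚ.n<1+n (suc s)) (ℕₚ.n<1+n (suc s)))

module _ (n : ℕ) where
  private
    s = proj₁ (floor-sqrt n)
    s²≤n = proj₁ (proj₂ (floor-sqrt n))
    n<s+1² = proj₂ (proj₂ (floor-sqrt n))

    small large : Fin s → ℕ
    small i = suc (toℕ i)
    large i = n / suc (toℕ i)

  -- A divisor of n is at most √n or has a cofactor at most √n.
  divisorCandidates : Fin (s + s) → ℕ
  divisorCandidates = small ++ large

  divisorCandidates-≤ : ∀ k → divisorCandidates k ≤ n
  divisorCandidates-≤ k with splitAt s k
  ... | inj₁ i = ℕₚ.≤-trans (Finₚ.toℕ<n i) (ℕₚ.≤-trans (m≤m² s) s²≤n)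
    where
    m≤m² : ∀ m → m ≤ m * m
    m≤m² zero    = z≤n
    m≤m² (suc m) = ℕₚ.m≤m*n (suc m) (suc m)
  ... | inj₂ i = m/n≤m n (suc (toℕ i))

  divisorCandidates-complete : 0 < n → ∀ d → d ℕᵈ.∣ n → ∃[ k ] divisorCandidates k ≡ d
  divisorCandidates-complete n>0 zero 0∣n = contradiction (≡.sym (ℕᵈ.0∣⇒≡0 0∣n)) (ℕₚ.<⇒≢ n>0)
  divisorCandidates-complete n>0 d@(suc d-1) (ℕᵈ.divides e n≡ed) with d ℕₚ.≤? s
  ... | yes d≤s = fromℕ< d≤s ↑ˡ s , ≡.trans
        (≡.cong [ small , large ] (Finₚ.splitAt-↑ˡ s (fromℕ< d≤s) s)) (≡.cong suc (Finₚ.toℕ-fromℕ< d≤s))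
  divisorCandidates-complete n>0 d (ℕᵈ.divides zero n≡0) | no d≰s = contradiction (≡.sym n≡0) (ℕₚ.<⇒≢ n>0)
  divisorCandidates-complete n>0 d (ℕᵈ.divides e@(suc e-1) n≡ed) | no d≰s = s ↑ʳ fromℕ< e≤s , ≡.trans
        (≡.cong [ small , large ] (Finₚ.splitAt-↑ʳ s s (fromℕ< e≤s)))
        (≡.trans (≡.cong (λ m → n / suc m) (Finₚ.toℕ-fromℕ< e≤s))
          (≡.trans (/-congˡ {o = e} (≡.trans n≡ed (ℕₚ.*-comm e d))) (m*n/n≡m d e)))
    where
    e≤s : e ≤ s
    -- If `d` and `e` both exceeded `s`, their product `n` would reach `(s + 1)²`.
    e≤s = ℕₚ.≮⇒≥ λ s<e → ℕₚ.<⇒≱ n<s+1²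
      (ℕₚ.≤-trans (ℕₚ.*-mono-≤ s<e (ℕₚ.≰⇒> d≰s)) (ℕₚ.≤-reflexive (≡.sym n≡ed)))

-- This is `C n ≤ 2 s Q` squared, with `s² ≤ n` and one factor `n` cancelled; 4 is the square of the
-- 2 from the two halves of the candidate list.
carmichaelCount-bound : ∀ {a ℓ q} (F : FiniteField a ℓ q) n → 0 < n →
                        let C = carmichaelCount F n ; Q = q ^ n in C * C * n ≤ 4 * (Q * Q)
carmichaelCount-bound {q = q} F n n>0 = ℕₚ.*-cancelʳ-≤ _ _ n {{ℕ.>-nonZero n>0}} (begin
  C * C * n * n                   ≡⟨ square C n ⟩
  (C * n) * (C * n)               ≤⟨ ℕₚ.*-mono-≤ Cn≤2sQ Cn≤2sQ ⟩
  (s + s) * Q * ((s + s) * Q)     ≡⟨ double s Q ⟩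
  4 * (Q * Q) * (s * s)           ≤⟨ ℕₚ.*-monoʳ-≤ (4 * (Q * Q)) s²≤n ⟩
  4 * (Q * Q) * n                 ∎)
  where
  open ℕₚ.≤-Reasoning
  C = carmichaelCount F n
  Q = q ^ n
  s = proj₁ (floor-sqrt n)
  s²≤n = proj₁ (proj₂ (floor-sqrt n))
  Cn≤2sQ : C * n ≤ (s + s) * Q
  Cn≤2sQ = CarmichaelPolynomials.carmichael-bound F (divisorCandidates n) (divisorCandidates-≤ n)
    (divisorCandidates-complete n n>0)
    (proj₂ (Polynomial.Count.carmichael-cardinality (FiniteField.commutativeRing F) (FiniteField.finite F) n))
  square : ∀ c m → c * c * m * m ≡ (c * m) * (c * m)
  square = solve-∀
  double : ∀ t u → (t + t) * u * ((t + t) * u) ≡ 4 * (u * u) * (t * t)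
  double = solve-∀

-- From the squared bound to rational and real exponents.

^-cancelˡ-≤ : ∀ {m n} o .{{_ : NonZero o}} → m ^ o ≤ n ^ o → m ≤ n
^-cancelˡ-≤ o m^o≤n^o = ℕₚ.≮⇒≥ λ n<m → ℕₚ.<⇒≱ (ℕₚ.^-monoˡ-< o n<m) m^o≤n^o

^-distribʳ-* : ∀ k m n → (m * n) ^ k ≡ m ^ k * n ^ k
^-distribʳ-* zero    m n = ≡.refl
^-distribʳ-* (suc k) m n = ≡.trans (≡.cong (m * n *_) (^-distribʳ-* k m n)) (interchange m n (m ^ k) (n ^ k))
  where
  interchange : ∀ a b c d → a * b * (c * d) ≡ a * c * (b * d)
  interchange = solve-∀

-- The inequality Cᴰ nᵏ ≤ Qᴰ, raised to the power 2b and multiplied by 4ᵇᴰ ≤ nᴰ.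
root-bound : ∀ {C Q n} b k D .{{_ : NonZero b}} .{{_ : NonZero n}} →
             C * C * n ≤ 4 * (Q * Q) → 4 ^ b ≤ n → 2 * (k * b) + D ≤ D * b →
             C ^ D * n ^ k ≤ Q ^ D
root-bound {C} {Q} {n} b k D bound 4^b≤n kb+D≤Db =
  ^-cancelˡ-≤ (2 * b) {{ℕₚ.m*n≢0 2 b}} (ℕₚ.*-cancelʳ-≤ _ _ (4 ^ (D * b)) {{ℕₚ.m^n≢0 4 (D * b)}} (begin
    (C ^ D * n ^ k) ^ (2 * b) * 4 ^ (D * b)
      ≤⟨ ℕₚ.*-monoʳ-≤ ((C ^ D * n ^ k) ^ (2 * b)) 4^Db≤n^D ⟩
    (C ^ D * n ^ k) ^ (2 * b) * n ^ D
      ≡⟨ ≡.cong (_* n ^ D) (^-distribʳ-* (2 * b) (C ^ D) (n ^ k)) ⟩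
    (C ^ D) ^ (2 * b) * (n ^ k) ^ (2 * b) * n ^ D
      ≡⟨ ≡.cong₂ (λ u v → u * v * n ^ D) (square-^ C) n^ ⟩
    (C * C) ^ (D * b) * n ^ (2 * (k * b)) * n ^ D      ≡⟨ ℕₚ.*-assoc ((C * C) ^ (D * b)) _ _ ⟩
    (C * C) ^ (D * b) * (n ^ (2 * (k * b)) * n ^ D)
      ≡⟨ ≡.cong ((C * C) ^ (D * b) *_) (ℕₚ.^-distribˡ-+-* n (2 * (k * b)) D) ⟨
    (C * C) ^ (D * b) * n ^ (2 * (k * b) + D)
      -- For positive `D` the hypothesis on exponents says `k / D + 1 / (2 b) ≤ 1 / 2`; the share
      -- `1 / (2 b)` pays for the constant, because `4 ^ b ≤ n` means that `n` to this power is at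
      -- least 2.
      ≤⟨ ℕₚ.*-monoʳ-≤ ((C * C) ^ (D * b)) (ℕₚ.^-monoʳ-≤ n kb+D≤Db) ⟩
    (C * C) ^ (D * b) * n ^ (D * b)                    ≡⟨ ^-distribʳ-* (D * b) (C * C) n ⟨
    (C * C * n) ^ (D * b)                              ≤⟨ ℕₚ.^-monoˡ-≤ (D * b) bound ⟩
    (4 * (Q * Q)) ^ (D * b)                            ≡⟨ ^-distribʳ-* (D * b) 4 (Q * Q) ⟩
    4 ^ (D * b) * (Q * Q) ^ (D * b)                    ≡⟨ ℕₚ.*-comm (4 ^ (D * b)) _ ⟩
    (Q * Q) ^ (D * b) * 4 ^ (D * b)                    ≡⟨ ≡.cong (_* 4 ^ (D * b)) (square-^ Q) ⟨
    (Q ^ D) ^ (2 * b) * 4 ^ (D * b)                    ∎))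
  where
  open ℕₚ.≤-Reasoning
  exponents : ∀ x y → x * (2 * y) ≡ 2 * (x * y)
  exponents = solve-∀
  n^ : (n ^ k) ^ (2 * b) ≡ n ^ (2 * (k * b))
  n^ = ≡.trans (ℕₚ.^-*-assoc n k (2 * b)) (≡.cong (n ^_) (exponents k b))
  square-^ : ∀ x → (x ^ D) ^ (2 * b) ≡ (x * x) ^ (D * b)
  square-^ x = ≡.trans (ℕₚ.^-*-assoc x D (2 * b)) (≡.trans (≡.cong (x ^_) (exponents D b))
    (≡.trans (≡.sym (ℕₚ.^-*-assoc x 2 (D * b))) (≡.cong (λ y → (x * y) ^ (D * b)) (ℕₚ.*-identityʳ x))))
  4^Db≤n^D : 4 ^ (D * b) ≤ n ^ D
  4^Db≤n^D = ℕₚ.≤-trans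
    (ℕₚ.≤-reflexive (≡.trans (≡.cong (4 ^_) (ℕₚ.*-comm D b)) (≡.sym (ℕₚ.^-*-assoc 4 b D))))
    (ℕₚ.^-monoˡ-≤ D 4^b≤n)

lower<upper : ∀ x {r s} → ℝ.lower x r → ℝ.upper x s → r ℚ.< s
lower<upper x {r} {s} l u with ℚₚ.<-cmp r s
... | tri< r<s _ _    = r<s
... | tri≈ _ ≡.refl _ = contradiction (l , u) (ℝ.disjoint x r)
... | tri> _ _ s<r    = contradiction (l , Equivalence.from (ℝ.upper-open x r) (s , s<r , u)) (ℝ.disjoint x r)

<-½-⇒+<½ : ∀ {r s} → s ℚ.< ½ ℚ.- r → r ℚ.+ s ℚ.< ½
<-½-⇒+<½ {r} {s} s<½-r = ≡.subst (r ℚ.+ s ℚ.<_) cancel (ℚₚ.+-monoʳ-< r s<½-r)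
  where
  open ≡.≡-Reasoning
  cancel : r ℚ.+ (½ ℚ.- r) ≡ ½
  cancel = begin
    r ℚ.+ (½ ℚ.- r)          ≡⟨ ℚₚ.+-comm r (½ ℚ.- r) ⟩
    (½ ℚ.- r) ℚ.+ r          ≡⟨ ℚₚ.+-assoc ½ (ℚ.- r) r ⟩
    ½ ℚ.+ (ℚ.- r ℚ.+ r)      ≡⟨ ≡.cong (½ ℚ.+_) (ℚₚ.+-inverseˡ r) ⟩
    ½ ℚ.+ 0ℚ                 ≡⟨ ℚₚ.+-identityʳ ½ ⟩
    ½                        ∎

open ℤ using (+_)

-- With `r = k / D` and `s = m / b`, clearing denominators in `r + s < ½` gives
-- `2 (k b + m D) < D b`. Positivity of `s` forces `m ≥ 1`, so `2 m D` may be lowered to `D`.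
exponent-bound : ∀ r s {k} → 0ℚ ℚ.< s → r ℚ.+ s ℚ.< ½ → ↥ r ≡ + k → 2 * (k * ↧ₙ s) + ↧ₙ r ≤ ↧ₙ r * ↧ₙ s
exponent-bound r@(ℚ.mkℚ (+ k) d _) s@(ℚ.mkℚ +[1+ m ] b _) 0<s r+s<½ ≡.refl = begin
  2 * (k * suc b) + suc d                    ≤⟨ ℕₚ.+-monoʳ-≤ (2 * (k * suc b)) (ℕₚ.m≤n*m (suc d) (suc m * 2)) ⟩
  2 * (k * suc b) + suc m * 2 * suc d        ≡⟨ regroup k (suc b) (suc m) (suc d) ⟩
  (k * suc b + suc m * suc d) * 2            ≤⟨ ℕₚ.<⇒≤ (ℤₚ.drop‿+<+ (ℤₚ.≤-<-trans (ℤₚ.≤-reflexive numerator)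
                                                  (ℤₚ.<-≤-trans cross (ℤₚ.≤-reflexive (ℤₚ.*-identityˡ _))))) ⟩
  suc d * suc b                              ∎
  where
  open ℕₚ.≤-Reasoning
  regroup : ∀ x y z w → 2 * (x * y) + z * 2 * w ≡ (x * y + z * w) * 2
  regroup = solve-∀
  cross : (+ k ℤ.* + suc b ℤ.+ + suc m ℤ.* + suc d) ℤ.* + 2 ℤ.< + 1 ℤ.* + (suc d * suc b)
  cross = ℚᵘₚ.drop-*<* (ℚᵘₚ.<-respˡ-≃ (ℚₚ.toℚᵘ-homo-+ r s) (ℚₚ.toℚᵘ-mono-< r+s<½))
  numerator : + ((k * suc b + suc m * suc d) * 2) ≡ (+ k ℤ.* + suc b ℤ.+ + suc m ℤ.* + suc d) ℤ.* + 2
  numerator = ≡.trans (ℤₚ.pos-* (k * suc b + suc m * suc d) 2)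
    (≡.cong (ℤ._* + 2) (≡.cong₂ ℤ._+_ (ℤₚ.pos-* k (suc b)) (ℤₚ.pos-* (suc m) (suc d))))
exponent-bound r (ℚ.mkℚ (+ 0) _ _)    (ℚ.*<* (ℤ.+<+ ())) _ _
exponent-bound r (ℚ.mkℚ -[1+ _ ] _ _) (ℚ.*<* ()) _ _

≤-/-^ℚ : ∀ {C Q n} r s .{{_ : NonZero n}} → 0ℚ ℚ.< s → r ℚ.+ s ℚ.< ½ → 4 ^ ↧ₙ s ≤ n →
         C * C * n ≤ 4 * (Q * Q) → C ≤ Q / n ^ℚ r
≤-/-^ℚ {C} {Q} {n} r s 0<s r+s<½ 4^b≤n bound with ↥ r in eq
... | + k      = root-bound {C} {Q} (↧ₙ s) k (↧ₙ r) bound 4^b≤n (exponent-bound r s 0<s r+s<½ eq)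
-- For negative `r` the power of `n` stands on the right, so `C ≤ Q` suffices; it follows from the
-- squared bound because `n ≥ 4`.
... | -[1+ k ] = ℕₚ.≤-trans (ℕₚ.^-monoˡ-≤ (↧ₙ r) C≤Q)
                   (ℕₚ.m≤m*n (Q ^ ↧ₙ r) (n ^ suc k) {{ℕₚ.m^n≢0 n (suc k)}})
  where
  open ℕₚ.≤-Reasoning
  4≤n : 4 ≤ n
  4≤n = ℕₚ.≤-trans (ℕₚ.^-monoʳ-≤ 4 {1} {↧ₙ s} (s≤s z≤n)) 4^b≤n
  C≤Q : C ≤ Q
  C≤Q = ℕₚ.≮⇒≥ λ Q<C → ℕₚ.<⇒≱ (ℕₚ.*-mono-< Q<C Q<C) (ℕₚ.*-cancelˡ-≤ 4 (begin
    4 * (C * C)   ≡⟨ ℕₚ.*-comm 4 (C * C) ⟩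
    C * C * 4     ≤⟨ ℕₚ.*-monoʳ-≤ (C * C) 4≤n ⟩
    C * C * n     ≤⟨ bound ⟩
    4 * (Q * Q)   ∎))

-- A rational `r` lies below `½ - ε` exactly when `½ - r` lies above `ε`; it is then above `s`,
-- which yields `r + s < ½`.
≤-/-^ℝ : ∀ C Q n ε s → 0ℚ ℚ.< s → ℝ.lower ε s → 4 ^ ↧ₙ s < n →
         C * C * n ≤ 4 * (Q * Q) → C ≤ Q / n ^ℝ (½ ℚ- ε)
≤-/-^ℝ C Q n ε s 0<s s<ε 4^b<n bound r r<½-ε =
  ≤-/-^ℚ {C} {Q} {n} r s {{ℕ.>-nonZero (ℕₚ.≤-<-trans z≤n 4^b<n)}} 0<s
    (<-½-⇒+<½ {r} {s} (lower<upper ε {s} {½ ℚ.- r} s<ε r<½-ε)) (ℕₚ.<⇒≤ 4^b<n) bound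

theorem4p6 : ∀ {a ℓ} (q : ℕ) → IsPrimePower q →
    (ε : ℝ) → ℝ.lower ε 0ℚ → ℝ.upper ε ½ →
    ∃[ c ] (∀ (F : FiniteField a ℓ q) (n : ℕ) → Composite n → c < n →
    carmichaelCount F n ≤ q ^ n / n ^ℝ (½ ℚ- ε))
theorem4p6 q _ ε 0<ε _ =
  let s , 0<s , s<ε = Equivalence.to (ℝ.lower-open ε 0ℚ) 0<ε in
  -- A positive rational with denominator `b` is at least `1 / b`, so beyond `4 ^ b` the power of
  -- `n` with exponent `s` exceeds 4.
  4 ^ ↧ₙ s , λ F n _ c<n →
    ≤-/-^ℝ (carmichaelCount F n) (q ^ n) n ε s 0<s s<ε c<n
      (carmichaelCount-bound F n (ℕₚ.≤-<-trans z≤n c<n))
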